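{- For all integers $n\geq 0$ we have $$H_n\big((2k+1)B_{2k}(\tfrac{1}{2})\big)=\prod_{\ell=1}^n\frac{\ell!^8}{(2\ell)!\,(2\ell+1)!}.$$
   Context: The Bernoulli polynomials $B_k(x)$ are defined by $\frac{te^{xt}}{e^t-1}=\sum_{k\ge 0}B_k(x)\frac{t^k}{k!}$. For a sequence $(c_0,c_1,\ldots)$ (indexed from $k=0$), $H_n(c_k)=\det\big(c_{i+j}\big)_{0\le i,j\le n}$; here $c_k=(2k+1)B_{2k}(\tfrac12)$. $\ell!^8=(\ell!)^8$, and empty products equal $1$. -}

module Defs where

import Algebra.Definitions.RawSemiring
open import Algebra.Properties.Monoid.Sum using (sum-cong-≗)
open import Data.Fin.Base using (Fin; zero; suc; toℕ; punchIn)
import Data.Integer.Base as ℤ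
open import Data.Nat.Base as ℕ using (ℕ; zero; suc; _∸_; _!)
open import Data.Nat.Properties using (_!≢0)
open import Data.Rational.Base
open import Data.Rational.Properties
import Data.Rational.Unnormalised.Base as ℚᵘ
import Data.Rational.Unnormalised.Properties as ℚᵘ
open import Relation.Binary.PropositionalEquality

open Algebra.Definitions.RawSemiring +-*-rawSemiring public
  using (sum; product; _^_)

fromℕ : ℕ → ℚ
fromℕ n = ℤ.+ n / 1

invFact : ℕ → ℚ
invFact n = (ℤ.+ 1 / n !) {{n !≢0}}

-- The sequence f : ℕ → ℚ stands for the formal power series Σₙ fₙ tⁿ.
Series : Set
Series = ℕ → ℚ

infixl 6 _⊖_
infixl 7 _⊛_ _⊘_
infixr 7 t·_

𝟙 : Series
𝟙 zero    = 1ℚ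
𝟙 (suc _) = 0ℚ

_⊖_ : Series → Series → Series
(f ⊖ g) n = f n - g n

_⊛_ : Series → Series → Series
(f ⊛ g) n = sum {suc n} λ i → f (toℕ i) * g (n ∸ toℕ i)

t·_ : Series → Series
(t· f) zero    = 0ℚ
(t· f) (suc n) = f n

-- For a series without constant term this is division by t.
tail : Series → Series
tail f n = f (suc n)

-- e^{xt}
exp : ℚ → Series
exp x n = x ^ n * invFact n

-- Long division: with q₀ = f₀ / g₀,
--   f / g = q₀ + t · (((f − q₀ g) / t) / g);
-- ⊘-correct below shows (f ⊘ g) ⊛ g = f.
_⊘_ : (f g : Series) .{{_ : NonZero (g 0)}} → Series
(f ⊘ g) zero    = f 0 ÷ g 0
(f ⊘ g) (suc n) = ((λ k → f (suc k) - (f 0 ÷ g 0) * g (suc k)) ⊘ g) n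

-- t e^{xt} / (e^t − 1).  Numerator and denominator both have zero constant
-- term, so a factor t is cancelled from each before dividing;
-- bernoulli-gf below is the resulting identity without cancellation.
bernoulliSeries : ℚ → Series
bernoulliSeries x = tail (t· exp x) ⊘ tail (exp 1ℚ ⊖ 𝟙)

-- The value Bₖ(x) of the k-th Bernoulli polynomial: the generating function
-- is exponential, so the coefficient of tᵏ is Bₖ(x) / k!.
B : ℕ → ℚ → ℚ
B k x = fromℕ (k !) * bernoulliSeries x k

Matrix : ℕ → Set
Matrix n = Fin n → Fin n → ℚ

-- Cofactor expansion along the first row.
det : ∀ {n} → Matrix n → ℚ
det {zero}  M = 1ℚ
det {suc n} M = sum {suc n} λ j →
  (- 1ℚ) ^ toℕ j * (M zero j * det λ i k → M (suc i) (punchIn j k))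

-- Indices run over 0 ≤ i , j ≤ n, so the matrix has size n + 1.
H : ℕ → (ℕ → ℚ) → ℚ
H n c = det {suc n} λ i j → c (toℕ i ℕ.+ toℕ j)

∏[ℓ=1⋯_] : ℕ → (ℕ → ℚ) → ℚ
∏[ℓ=1⋯ n ] f = product {n} λ i → f (suc (toℕ i))

private
  cancel : ∀ a b → a + (b - a) ≡ b
  cancel a b = begin
    a + (b - a)    ≡⟨ cong (a +_) (+-comm b (- a)) ⟩
    a + (- a + b)  ≡⟨ +-assoc a (- a) b ⟨
    (a - a) + b    ≡⟨ cong (_+ b) (+-inverseʳ a) ⟩
    0ℚ + b         ≡⟨ +-identityˡ b ⟩
    b              ∎
    where open ≡-Reasoning

  ÷-* : ∀ a b .{{_ : NonZero b}} → (a ÷ b) * b ≡ a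
  ÷-* a b = trans (*-assoc a (1/ b) b)
    (trans (cong (a *_) (*-inverseˡ b)) (*-identityʳ a))

⊘-correct : ∀ f g .{{_ : NonZero (g 0)}} n → ((f ⊘ g) ⊛ g) n ≡ f n
⊘-correct f g zero    = trans (+-identityʳ _) (÷-* (f 0) (g 0))
⊘-correct f g (suc n) = trans
  (cong ((f 0 ÷ g 0) * g (suc n) +_)
    (⊘-correct (λ k → f (suc k) - (f 0 ÷ g 0) * g (suc k)) g n))
  (cancel ((f 0 ÷ g 0) * g (suc n)) (f (suc n)))

private
  ⊛-zero : ∀ f g → g 0 ≡ 0ℚ → (f ⊛ g) 0 ≡ 0ℚ
  ⊛-zero f g eq = trans (+-identityʳ _) (trans (cong (f 0 *_) eq) (*-zeroʳ (f 0)))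

  ⊛-tail : ∀ f g → g 0 ≡ 0ℚ → ∀ n → (f ⊛ g) (suc n) ≡ (f ⊛ tail g) n
  ⊛-tail f g eq zero    = cong (f 0 * g 1 +_) (⊛-zero (tail f) g eq)
  ⊛-tail f g eq (suc n) = cong (f 0 * g (suc (suc n)) +_) (⊛-tail (tail f) g eq n)

  ⊛-congˡ : ∀ {f f′} g → f ≗ f′ → f ⊛ g ≗ f′ ⊛ g
  ⊛-congˡ g f≗f′ n = sum-cong-≗ +-0-monoid {suc n}
    λ i → cong (_* g (n ∸ toℕ i)) (f≗f′ (toℕ i))

  m*1/m : ∀ m .{{_ : ℕ.NonZero m}} → fromℕ m * (ℤ.+ 1 / m) ≡ 1ℚ
  m*1/m (suc k) = toℚᵘ-injective (begin
    toℚᵘ (fromℕ (suc k) * (ℤ.+ 1 / suc k))            ≈⟨ toℚᵘ-homo-* (fromℕ (suc k)) (ℤ.+ 1 / suc k) ⟩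
    toℚᵘ (fromℕ (suc k)) ℚᵘ.* toℚᵘ (ℤ.+ 1 / suc k)    ≈⟨ ℚᵘ.*-cong (toℚᵘ-fromℚᵘ m) (toℚᵘ-fromℚᵘ 1/m) ⟩
    m ℚᵘ.* 1/m                                      ≈⟨ ℚᵘ.*-inverseʳ m ⟩
    ℚᵘ.1ℚᵘ                                          ∎)
    where
    open ℚᵘ.≃-Reasoning
    m   = ℚᵘ.mkℚᵘ (ℤ.+ suc k) 0
    1/m = ℚᵘ.mkℚᵘ (ℤ.+ 1) k

  B-coeff : ∀ x k → B k x * invFact k ≡ bernoulliSeries x k
  B-coeff x k = begin
    (k! * b) * invFact k  ≡⟨ cong (_* invFact k) (*-comm k! b) ⟩
    (b * k!) * invFact k  ≡⟨ *-assoc b k! (invFact k) ⟩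
    b * (k! * invFact k)  ≡⟨ cong (b *_) (m*1/m (k !) {{k !≢0}}) ⟩
    b * 1ℚ                ≡⟨ *-identityʳ b ⟩
    b                     ∎
    where
    open ≡-Reasoning
    k! = fromℕ (k !)
    b  = bernoulliSeries x k

-- (Σₖ Bₖ(x) tᵏ / k!) · (e^t − 1) = t e^{xt}
bernoulli-gf : ∀ x → (λ k → B k x * invFact k) ⊛ (exp 1ℚ ⊖ 𝟙) ≗ t· exp x
bernoulli-gf x n = trans (⊛-congˡ d (B-coeff x) n) (lemma n)
  where
  d = exp 1ℚ ⊖ 𝟙
  lemma : bernoulliSeries x ⊛ d ≗ t· exp x
  lemma zero    = ⊛-zero (bernoulliSeries x) d refl
  lemma (suc n) = trans (⊛-tail (bernoulliSeries x) d refl n)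
    (⊘-correct (tail (t· exp x)) (tail d) n)

{-# OPTIONS --safe #-}

-- Write L for the functional zᵏ ↦ cₖ on polynomials.  With
-- μₙ = n Bₙ₋₁(½) we have cₖ = μ₂ₖ₊₁, so L(q) is the value of q(x²) x under the
-- functional μ : f ↦ f′(B(½)).  The generating function of the Bernoulli
-- numbers says μ(f(x + 1) − f(x)) = f″(½).  Since x φₖ(x²), for
-- φₖ(z) = ∏_{j<k} ((j + ½)² − z), is up to a factor the central difference of
-- ∏_{j≤k} (j² − x²), this yields L(φₖ) = k!² / (k + 1).
--
-- This determines L, whose monic orthogonal polynomials pⱼ are the Wilson
-- polynomials with all four parameters equal to ½ (in z = −t²).  They are
-- built from their three-term recurrence, along which L(φᵢ pⱼ) keeps a closed
-- product form that vanishes for i < j.  Passing from the columns zʲ to pⱼ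
-- makes the Hankel matrix lower triangular with diagonal entries L(zʲ pⱼ).

module Submission where

open import Defs
open import Algebra.Bundles using (Ring)
open import Algebra.Properties.Monoid.Sum using (sum-cong-≗)
open import Algebra.Properties.Semiring.Sum using (*-distribˡ-sum)
open import Data.Fin.Base as Fin using (Fin; zero; suc; toℕ; punchIn)
import Data.Integer.Base as ℤ
import Data.Integer.Properties as ℤ
open import Data.List.Base using (List; []; _∷_; _++_; tabulate; applyUpTo)
open import Data.List.Membership.Propositional using (_∈_)
open import Data.List.Membership.Propositional.Properties
  using (∈-∃++; ∈-applyUpTo⁺; ∈-applyUpTo⁻)
open import Data.List.Properties using (++-assoc; ++-identityʳ)
open import Data.Nat.Base as ℕ using (ℕ; zero; suc; _!)
import Data.Nat.Properties as ℕ
open import Data.Nat.Properties using (_!*_!≢0)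
open import Data.Product.Base using (_×_; _,_; ∃-syntax)
open import Data.Rational.Base
open import Data.Rational.Properties
open import Data.Rational.Solver
import Data.Rational.Unnormalised.Base as ℚᵘ
import Data.Rational.Unnormalised.Properties as ℚᵘ
open import Function.Base using (_∘_)
open import Relation.Binary.PropositionalEquality
open +-*-Solver

-- Determinants as alternating functions of the list of columns

-- A column is an infinite sequence of which a determinant reads only finitely many rows, so
-- shifting a column by `tail` stays within the same type.
Functional : Set
Functional = List Series → ℚ

-- `linear` receives its sum through a pointwise equation, so it also yields invariance under
-- pointwise equality (take `a = 0`) without function extensionality.
record IsAlternating (F : Functional) : Set where
  field
    linear : ∀ pre post {u v w} a → (∀ n → w n ≡ u n + a * v n) →
      F (pre ++ w ∷ post) ≡ F (pre ++ u ∷ post) + a * F (pre ++ v ∷ post)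
    adjacent-equal : ∀ pre post u → F (pre ++ u ∷ u ∷ post) ≡ 0ℚ

open IsAlternating

∘-∷-isAlternating : ∀ {F} c → IsAlternating F → IsAlternating (F ∘ (c ∷_))
∘-∷-isAlternating c F-alt .linear pre = linear F-alt (c ∷ pre)
∘-∷-isAlternating c F-alt .adjacent-equal pre = adjacent-equal F-alt (c ∷ pre)

-- Expansion along row `r`. The functional `F ∘ (c ∷_)` remembers the columns already passed, and
-- the nested subtractions produce the alternating signs.
laplace : ℕ → Functional → Functional
laplace r F []       = 0ℚ
laplace r F (c ∷ cs) = c r * F cs - laplace r (F ∘ (c ∷_)) cs

-- Only lists of the right length have a determinant; all others get 0, so
-- that no lemma below needs a length hypothesis.
listDet : List ℕ → Functional
listDet []       []      = 1ℚ
listDet []       (_ ∷ _) = 0ℚ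
listDet (r ∷ rs) cs      = laplace r (listDet rs) cs

laplace-zero : ∀ r {F} → (∀ cs → F cs ≡ 0ℚ) → ∀ cs → laplace r F cs ≡ 0ℚ
laplace-zero r F≡0 []       = refl
laplace-zero r F≡0 (c ∷ cs) = trans
  (cong₂ (λ x y → c r * x - y) (F≡0 cs) (laplace-zero r (λ cs → F≡0 (c ∷ cs)) cs))
  (solve 1 (λ x → x :* con 0ℚ :- con 0ℚ := con 0ℚ) refl (c r))

laplace-linear : ∀ r {F G H : Functional} a → (∀ cs → H cs ≡ F cs + a * G cs) →
  ∀ cs → laplace r H cs ≡ laplace r F cs + a * laplace r G cs
laplace-linear r a eq [] = solve 1 (λ x → con 0ℚ := con 0ℚ :+ x :* con 0ℚ) refl a
laplace-linear r {F} {G} a eq (c ∷ cs) = trans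
  (cong₂ (λ x y → c r * x - y) (eq cs) (laplace-linear r a (λ cs → eq (c ∷ cs)) cs))
  (solve 6 (λ a c f g f' g' → c :* (f :+ a :* g) :- (f' :+ a :* g')
      := (c :* f :- f') :+ a :* (c :* g :- g')) refl
    a (c r) (F cs) (G cs) (laplace r (F ∘ (c ∷_)) cs) (laplace r (G ∘ (c ∷_)) cs))

laplace-isAlternating : ∀ r {F} → IsAlternating F → IsAlternating (laplace r F)
laplace-isAlternating r {F} F-alt .linear [] post {u} {v} {w} a eq = trans
  (cong₂ (λ x y → x * F post - y) (eq r)
    (laplace-linear r a (λ cs → linear F-alt [] cs a eq) post))
  (solve 6 (λ a u v f f' g' → (u :+ a :* v) :* f :- (f' :+ a :* g')
      := (u :* f :- f') :+ a :* (v :* f :- g')) refl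
    a (u r) (v r) (F post) (laplace r (F ∘ (u ∷_)) post) (laplace r (F ∘ (v ∷_)) post))
laplace-isAlternating r {F} F-alt .linear (c ∷ pre) post {u} {v} {w} a eq = trans
  (cong₂ (λ x y → c r * x - y) (linear F-alt pre post a eq)
    (linear (laplace-isAlternating r (∘-∷-isAlternating c F-alt)) pre post a eq))
  (solve 6 (λ a c f g f' g' → c :* (f :+ a :* g) :- (f' :+ a :* g')
      := (c :* f :- f') :+ a :* (c :* g :- g')) refl
    a (c r) (F (pre ++ u ∷ post)) (F (pre ++ v ∷ post))
    (laplace r (F ∘ (c ∷_)) (pre ++ u ∷ post)) (laplace r (F ∘ (c ∷_)) (pre ++ v ∷ post)))
-- Deleting either copy of `u` gives the same minor with opposite signs; every later term keeps both
-- copies and vanishes.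
laplace-isAlternating r {F} F-alt .adjacent-equal [] post u = trans
  (cong (λ y → u r * F (u ∷ post) - (u r * F (u ∷ post) - y))
    (laplace-zero r (λ cs → adjacent-equal F-alt [] cs u) post))
  (solve 1 (λ x → x :- (x :- con 0ℚ) := con 0ℚ) refl (u r * F (u ∷ post)))
laplace-isAlternating r {F} F-alt .adjacent-equal (c ∷ pre) post u = trans
  (cong₂ (λ x y → c r * x - y) (adjacent-equal F-alt pre post u)
    (adjacent-equal (laplace-isAlternating r (∘-∷-isAlternating c F-alt)) pre post u))
  (solve 1 (λ x → x :* con 0ℚ :- con 0ℚ := con 0ℚ) refl (c r))

listDet-isAlternating : ∀ rs → IsAlternating (listDet rs)
listDet-isAlternating [] = record { linear = lin ; adjacent-equal = adj }
  where
  vanish : ∀ pre {u post} → listDet [] (pre ++ u ∷ post) ≡ 0ℚ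
  vanish []      = refl
  vanish (_ ∷ _) = refl
  lin : ∀ pre post {u v w} a → (∀ n → w n ≡ u n + a * v n) →
    listDet [] (pre ++ w ∷ post) ≡ listDet [] (pre ++ u ∷ post) + a * listDet [] (pre ++ v ∷ post)
  lin pre post a _ = trans (vanish pre) (sym (trans
    (cong₂ (λ x y → x + a * y) (vanish pre) (vanish pre))
    (solve 1 (λ x → con 0ℚ :+ x :* con 0ℚ := con 0ℚ) refl a)))
  adj : ∀ pre post u → listDet [] (pre ++ u ∷ u ∷ post) ≡ 0ℚ
  adj pre post u = vanish pre
listDet-isAlternating (r ∷ rs) = laplace-isAlternating r (listDet-isAlternating rs)

det-cong : ∀ {n} {M N : Matrix n} → (∀ i j → M i j ≡ N i j) → det M ≡ det N
det-cong {zero}  eq = refl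
det-cong {suc n} eq = sum-cong-≗ +-0-monoid {suc n} λ j →
  cong₂ (λ x y → (- 1ℚ) ^ toℕ j * (x * y)) (eq zero j)
    (det-cong λ i k → eq (suc i) (punchIn j k))

-- One factor -1 comes out of the sum over the later columns and becomes the subtraction in
-- `laplace`. `F` is general because the induction applies to `F ∘ (cs zero ∷_)`.
laplace-tabulate : ∀ r F n (cs : Fin (suc n) → Series) →
  sum {suc n} (λ j → (- 1ℚ) ^ toℕ j * (cs j r * F (tabulate (cs ∘ punchIn j))))
    ≡ laplace r F (tabulate cs)
laplace-tabulate r F zero cs =
  solve 1 (λ x → con 1ℚ :* x :+ con 0ℚ := x :- con 0ℚ) refl (cs zero r * F [])
laplace-tabulate r F (suc n) cs = begin
  1ℚ * x + sum {suc n} (λ j → - 1ℚ * s j * y j)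
    ≡⟨ cong (1ℚ * x +_) (sum-cong-≗ +-0-monoid {suc n} λ j → *-assoc (- 1ℚ) (s j) (y j)) ⟩
  1ℚ * x + sum {suc n} (λ j → - 1ℚ * (s j * y j))
    ≡⟨ cong (1ℚ * x +_) (*-distribˡ-sum (Ring.semiring +-*-ring) (- 1ℚ) (λ j → s j * y j)) ⟨
  1ℚ * x + - 1ℚ * sum {suc n} (λ j → s j * y j)
    ≡⟨ cong (λ z → 1ℚ * x + - 1ℚ * z) (laplace-tabulate r (F ∘ (cs zero ∷_)) n (cs ∘ suc)) ⟩
  1ℚ * x + - 1ℚ * l
    ≡⟨ solve 2 (λ x l → con 1ℚ :* x :+ con (- 1ℚ) :* l := x :- l) refl x l ⟩
  x - l ∎
  where
  open ≡-Reasoning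
  x = cs zero r * F (tabulate (cs ∘ suc))
  l = laplace r (F ∘ (cs zero ∷_)) (tabulate (cs ∘ suc))
  s y : Fin (suc n) → ℚ
  s j = (- 1ℚ) ^ toℕ j
  y j = cs (suc j) r * F (tabulate (cs ∘ punchIn (suc j)))

det≡listDet : ∀ n (rs : Fin n → ℕ) (cs : Fin n → Series) →
  det (λ i j → cs j (rs i)) ≡ listDet (tabulate rs) (tabulate cs)
det≡listDet zero    rs cs = refl
det≡listDet (suc n) rs cs = trans
  (sum-cong-≗ +-0-monoid {suc n} λ j →
    cong (λ x → (- 1ℚ) ^ toℕ j * (cs j (rs zero) * x)) (det≡listDet n (rs ∘ suc) (cs ∘ punchIn j)))
  (laplace-tabulate (rs zero) (listDet (tabulate (rs ∘ suc))) n cs)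

-- Only the corner entry of the first row survives, and its minor is again lower triangular.
det-lowerTriangular : ∀ {n} (M : Matrix n) → (∀ {i j} → i Fin.< j → M i j ≡ 0ℚ) →
  det M ≡ product {n} λ i → M i i
det-lowerTriangular {zero}  M _ = refl
det-lowerTriangular {suc n} M M≡0 = begin
  1ℚ * (M zero zero * d) + sum {n} rest
    ≡⟨ cong (1ℚ * (M zero zero * d) +_) (trans
         (sum-cong-≗ +-0-monoid {n} λ j → trans
           (cong (λ x → (- 1ℚ) ^ toℕ (suc j) * (x * e j)) (M≡0 {zero} {suc j} (ℕ.s≤s ℕ.z≤n)))
           (solve 2 (λ s x → s :* (con 0ℚ :* x) := con 0ℚ :* (s :* x)) refl ((- 1ℚ) ^ toℕ (suc j)) (e j)))
         (sym (*-distribˡ-sum (Ring.semiring +-*-ring) 0ℚ (λ j → (- 1ℚ) ^ toℕ (suc j) * e j)))) ⟩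
  1ℚ * (M zero zero * d) + 0ℚ * S
    ≡⟨ solve 2 (λ x y → con 1ℚ :* x :+ con 0ℚ :* y := x) refl (M zero zero * d) S ⟩
  M zero zero * d
    ≡⟨ cong (M zero zero *_) (det-lowerTriangular (λ i k → M (suc i) (suc k)) λ i<j → M≡0 (ℕ.s≤s i<j)) ⟩
  M zero zero * product {n} (λ i → M (suc i) (suc i)) ∎
  where
  open ≡-Reasoning
  d = det λ i k → M (suc i) (suc k)
  e rest : Fin n → ℚ
  e j = det λ i k → M (suc i) (punchIn (suc j) k)
  rest j = (- 1ℚ) ^ toℕ (suc j) * (M zero (suc j) * e j)
  S = sum {n} λ j → (- 1ℚ) ^ toℕ (suc j) * e j

-- With u + v in both columns `F` vanishes; expanding by linearity leaves the two mixed terms, since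
-- equal columns give zero.
adjacent-swap : ∀ {F} → IsAlternating F → ∀ pre post u v →
  F (pre ++ u ∷ v ∷ post) ≡ - F (pre ++ v ∷ u ∷ post)
adjacent-swap F-alt (c ∷ pre) = adjacent-swap (∘-∷-isAlternating c F-alt) pre
adjacent-swap {F} F-alt [] post u v = begin
  x
    ≡⟨ solve 4 (λ uu x y vv → x := (uu :+ con 1ℚ :* x) :+ con 1ℚ :* (y :+ con 1ℚ :* vv) :- (uu :+ y :+ vv)) refl uu x y vv ⟩
  (uu + 1ℚ * x) + 1ℚ * (y + 1ℚ * vv) - (uu + y + vv)
    ≡⟨ cong₂ (λ p q → p + 1ℚ * q - (uu + y + vv)) (linear₂ u) (linear₂ v) ⟨
  F (u ∷ s ∷ post) + 1ℚ * F (v ∷ s ∷ post) - (uu + y + vv)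
    ≡⟨ cong (_- (uu + y + vv)) (linear F-alt [] (s ∷ post) 1ℚ λ _ → refl) ⟨
  F (s ∷ s ∷ post) - (uu + y + vv)
    ≡⟨ cong₂ (λ p q → p - q) (adjacent-equal F-alt [] post s)
         (cong₂ (λ p q → p + y + q) (adjacent-equal F-alt [] post u) (adjacent-equal F-alt [] post v)) ⟩
  0ℚ - (0ℚ + y + 0ℚ)
    ≡⟨ solve 1 (λ y → con 0ℚ :- (con 0ℚ :+ y :+ con 0ℚ) := :- y) refl y ⟩
  - y ∎
  where
  open ≡-Reasoning
  s : Series
  s n = u n + 1ℚ * v n
  linear₂ : ∀ w → F (w ∷ s ∷ post) ≡ F (w ∷ u ∷ post) + 1ℚ * F (w ∷ v ∷ post)
  linear₂ w = linear F-alt (w ∷ []) post 1ℚ λ _ → refl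
  uu = F (u ∷ u ∷ post)
  x  = F (u ∷ v ∷ post)
  y  = F (v ∷ u ∷ post)
  vv = F (v ∷ v ∷ post)

-- Adjacent swaps carry the first copy of `u` through `mid` until the two copies meet.
equal-columns : ∀ {F} → IsAlternating F → ∀ pre mid post u →
  F (pre ++ u ∷ mid ++ u ∷ post) ≡ 0ℚ
equal-columns F-alt (c ∷ pre) mid = equal-columns (∘-∷-isAlternating c F-alt) pre mid
equal-columns F-alt [] []        post u = adjacent-equal F-alt [] post u
equal-columns F-alt [] (m ∷ mid) post u = trans
  (adjacent-swap F-alt [] (mid ++ u ∷ post) u m)
  (cong -_ (equal-columns (∘-∷-isAlternating m F-alt) [] mid post u))

-- Spans and unitriangular column operations

data Span (V : Series → Set) (w : Series) : Set where
  zero : (∀ n → w n ≡ 0ℚ) → Span V w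
  add  : ∀ {u v} a → Span V u → V v → (∀ n → w n ≡ u n + a * v n) → Span V w

Span-map : ∀ {V W} (f : Series → Series) →
  (∀ {w} → (∀ n → w n ≡ 0ℚ) → ∀ n → f w n ≡ 0ℚ) →
  (∀ {u v w} a → (∀ n → w n ≡ u n + a * v n) → ∀ n → f w n ≡ f u n + a * f v n) →
  (∀ {v} → V v → W (f v)) → ∀ {w} → Span V w → Span W (f w)
Span-map f f-zero f-linear V⇒W (zero w≡0)      = zero (f-zero w≡0)
Span-map f f-zero f-linear V⇒W (add a u∈ v∈ eq) =
  add a (Span-map f f-zero f-linear V⇒W u∈) (V⇒W v∈) (f-linear a eq)

Span-mono : ∀ {V W : Series → Set} → (∀ {v} → V v → W v) → ∀ {w} → Span V w → Span W w
Span-mono = Span-map (λ w → w) (λ eq → eq) (λ _ eq → eq)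

Span-tail : ∀ {V W : Series → Set} → (∀ {v} → V v → W (tail v)) → ∀ {w} → Span V w → Span W (tail w)
Span-tail = Span-map tail (λ eq n → eq (suc n)) (λ _ eq n → eq (suc n))

Span-linear : ∀ {V u v w} a → Span V u → Span V v → (∀ n → w n ≡ u n + a * v n) → Span V w
Span-linear {u = u} {v} a (zero u≡0) (zero v≡0) eq = zero λ n → trans (eq n)
  (trans (cong₂ (λ x y → x + a * y) (u≡0 n) (v≡0 n))
    (solve 1 (λ a → con 0ℚ :+ a :* con 0ℚ := con 0ℚ) refl a))
Span-linear {u = u} {v} a (add {u′} {v′} b u′∈ v′∈ eq′) (zero v≡0) eq = add b u′∈ v′∈ λ n → trans (eq n)
  (trans (cong₂ (λ x y → x + a * y) (eq′ n) (v≡0 n))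
    (solve 4 (λ x y a b → x :+ b :* y :+ a :* con 0ℚ := x :+ b :* y) refl (u′ n) (v′ n) a b))
Span-linear {u = u} {v} a u∈ (add {u′} {v′} b u′∈ v′∈ eq′) eq =
  add (a * b) (Span-linear {w = λ n → u n + a * u′ n} a u∈ u′∈ λ _ → refl) v′∈ λ n → trans (eq n)
  (trans (cong (λ y → u n + a * y) (eq′ n))
    (solve 5 (λ u x y a b → u :+ a :* (x :+ b :* y) := u :+ a :* x :+ a :* b :* y) refl (u n) (u′ n) (v′ n) a b))

-- Linearity reduces to the generators of the span, each of which repeats a column of `pre`.
dependent-column : ∀ {F} → IsAlternating F → ∀ pre post {w} → Span (_∈ pre) w →
  F (pre ++ w ∷ post) ≡ 0ℚ
dependent-column {F} F-alt pre post {w} (zero w≡0) = trans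
  -- A zero column satisfies w = w - w, so linearity gives a value minus itself.
  (linear F-alt pre post {w} {w} (- 1ℚ) λ n →
    trans (w≡0 n) (sym (cong (λ x → x + - 1ℚ * x) (w≡0 n))))
  (solve 1 (λ x → x :+ con (- 1ℚ) :* x := con 0ℚ) refl (F (pre ++ w ∷ post)))
dependent-column {F} F-alt pre post (add {u} {v} a u∈ v∈ eq) = trans
  (linear F-alt pre post a eq)
  (trans (cong₂ (λ x y → x + a * y) (dependent-column F-alt pre post u∈) (repeated v∈))
    (solve 1 (λ a → con 0ℚ :+ a :* con 0ℚ := con 0ℚ) refl a))
  where
  repeated : v ∈ pre → F (pre ++ v ∷ post) ≡ 0ℚ
  repeated v∈pre with ys , zs , refl ← ∈-∃++ v∈pre =
    trans (cong F (++-assoc ys (v ∷ zs) (v ∷ post))) (equal-columns F-alt ys zs post v)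

-- p is M j plus a linear combination of pre and M 0 , … , M (j ∸ 1).
MonicOver : List Series → (ℕ → Series) → ℕ → Series → Set
MonicOver pre M j p = ∃[ w ] Span (_∈ pre ++ applyUpTo M j) w × (∀ n → p n ≡ M j n + 1ℚ * w n)

-- The columns are replaced from left to right. Each finished `M` column joins `pre`, so the next
-- `P` column differs from its `M` column by a combination of columns to its left.
unitriangular-columns : ∀ {F} → IsAlternating F → ∀ n pre (P M : ℕ → Series) →
  (∀ j → MonicOver pre M j (P j)) →
  F (pre ++ applyUpTo P n) ≡ F (pre ++ applyUpTo M n)
unitriangular-columns F-alt zero pre P M P-monic = refl
unitriangular-columns {F} F-alt (suc n) pre P M P-monic with P-monic 0
... | w , w∈ , eq = begin
  F (pre ++ P 0 ∷ Ps)
    ≡⟨ linear F-alt pre Ps 1ℚ eq ⟩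
  F (pre ++ M 0 ∷ Ps) + 1ℚ * F (pre ++ w ∷ Ps)
    ≡⟨ cong (λ x → F (pre ++ M 0 ∷ Ps) + 1ℚ * x) (dependent-column F-alt pre Ps
         (subst (λ l → Span (_∈ l) w) (++-identityʳ pre) w∈)) ⟩
  F (pre ++ M 0 ∷ Ps) + 0ℚ
    ≡⟨ +-identityʳ _ ⟩
  F (pre ++ M 0 ∷ Ps)
    ≡⟨ cong F (++-assoc pre (M 0 ∷ []) Ps) ⟨
  F ((pre ++ M 0 ∷ []) ++ Ps)
    ≡⟨ unitriangular-columns F-alt n (pre ++ M 0 ∷ []) (P ∘ suc) (M ∘ suc) P-monic′ ⟩
  F ((pre ++ M 0 ∷ []) ++ applyUpTo (M ∘ suc) n)
    ≡⟨ cong F (++-assoc pre (M 0 ∷ []) _) ⟩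
  F (pre ++ applyUpTo M (suc n)) ∎
  where
  open ≡-Reasoning
  Ps = applyUpTo (P ∘ suc) n
  P-monic′ : ∀ j → MonicOver (pre ++ M 0 ∷ []) (M ∘ suc) j (P (suc j))
  P-monic′ j with P-monic (suc j)
  ... | w , w∈ , eq = w , subst (λ l → Span (_∈ l) w) (sym (++-assoc pre (M 0 ∷ []) _)) w∈ , eq

tabulate-toℕ : ∀ (f : ℕ → Series) n → tabulate {n = n} (f ∘ toℕ) ≡ applyUpTo f n
tabulate-toℕ f zero    = refl
tabulate-toℕ f (suc n) = cong (f 0 ∷_) (tabulate-toℕ (f ∘ suc) n)

det-unitriangular : ∀ n (P M : ℕ → Series) → (∀ j → MonicOver [] M j (P j)) →
  det {n} (λ i j → P (toℕ j) (toℕ i)) ≡ det {n} (λ i j → M (toℕ j) (toℕ i))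
det-unitriangular n P M P-monic = begin
  det {n} (λ i j → P (toℕ j) (toℕ i))             ≡⟨ det≡listDet n toℕ (P ∘ toℕ) ⟩
  listDet rows (tabulate {n = n} (P ∘ toℕ))       ≡⟨ cong (listDet rows) (tabulate-toℕ P n) ⟩
  listDet rows (applyUpTo P n)                    ≡⟨ unitriangular-columns (listDet-isAlternating rows) n [] P M P-monic ⟩
  listDet rows (applyUpTo M n)                    ≡⟨ cong (listDet rows) (tabulate-toℕ M n) ⟨
  listDet rows (tabulate {n = n} (M ∘ toℕ))       ≡⟨ det≡listDet n toℕ (M ∘ toℕ) ⟨
  det {n} (λ i j → M (toℕ j) (toℕ i))             ∎
  where
  open ≡-Reasoning
  rows = tabulate {n = n} toℕ

-- Hankel determinants and three-term recurrences

hankelColumn : Series → ℕ → Series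
hankelColumn c zero    = c
hankelColumn c (suc j) = tail (hankelColumn c j)

-- The columns are iterated shifts because multiplication by z acts on value sequences as `tail`;
-- this recovers the Hankel entries.
hankelColumn-+ : ∀ c j i → hankelColumn c j i ≡ c (i ℕ.+ j)
hankelColumn-+ c zero    i = cong c (sym (ℕ.+-identityʳ i))
hankelColumn-+ c (suc j) i = trans (hankelColumn-+ c j (suc i)) (cong c (sym (ℕ.+-suc i j)))

-- p_{j+1}(z) = (z − a_j) p_j(z) − b_{j-1} p_{j-1}(z), each polynomial p being
-- represented by the sequence of the values L(zⁿ p) of the functional L(zⁿ) = cₙ.
threeTerm : (a b c : Series) → ℕ → Series
threeTerm a b c zero          n = c n
threeTerm a b c (suc zero)    n = c (suc n) - a 0 * c n
threeTerm a b c (suc (suc j)) n =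
  threeTerm a b c (suc j) (suc n) - a (suc j) * threeTerm a b c (suc j) n - b j * threeTerm a b c j n

-- Multiplication by z sends the leading column to the next one and raises the index of each
-- generator of the remainder by one; the two subtracted terms only involve columns before the new
-- leading one.
threeTerm-monic : ∀ a b c j → MonicOver [] (hankelColumn c) j (threeTerm a b c j)
threeTerm-monic a b c = monic
  where
  M = hankelColumn c
  Before : ℕ → Series → Set
  Before j v = v ∈ applyUpTo M j

  weaken : ∀ {j w} → Span (Before j) w → Span (Before (suc j)) w
  weaken = Span-mono λ v∈ → case (∈-applyUpTo⁻ M v∈)
    where
    case : ∀ {j v} → ∃[ i ] i ℕ.< j × v ≡ M i → Before (suc j) v
    case (i , i<j , refl) = ∈-applyUpTo⁺ M (ℕ.m≤n⇒m≤1+n i<j)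

  shift : ∀ {j w} → Span (Before j) w → Span (Before (suc j)) (tail w)
  shift = Span-tail λ v∈ → case (∈-applyUpTo⁻ M v∈)
    where
    case : ∀ {j v} → ∃[ i ] i ℕ.< j × v ≡ M i → Before (suc j) (tail v)
    case (i , i<j , refl) = ∈-applyUpTo⁺ M (ℕ.s≤s i<j)

  monic⇒span : ∀ {j p} → MonicOver [] M j p → Span (Before (suc j)) p
  monic⇒span {j} (w , w∈ , eq) = add 1ℚ (weaken w∈) (∈-applyUpTo⁺ M (ℕ.n<1+n j))
    λ n → trans (eq n) (solve 2 (λ x y → x :+ con 1ℚ :* y := y :+ con 1ℚ :* x) refl (M j n) (w n))

  monic : ∀ j → MonicOver [] M j (threeTerm a b c j)
  monic zero = (λ _ → 0ℚ) , zero (λ _ → refl) , λ n → sym (+-identityʳ (c n))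
  monic (suc zero) = (λ n → 0ℚ + - a 0 * c n)
    , add (- a 0) (zero {w = λ _ → 0ℚ} λ _ → refl) (∈-applyUpTo⁺ M {n = 1} (ℕ.s≤s ℕ.z≤n)) (λ _ → refl)
    , λ n → solve 3 (λ x a y → x :- a :* y := x :+ con 1ℚ :* (con 0ℚ :+ (:- a) :* y)) refl (c (suc n)) (a 0) (c n)
  monic (suc (suc j)) with monic j | monic (suc j)
  ... | p-monic | q-monic@(w , w∈ , eq) = r , r∈ , λ n → trans
    (cong (λ x → x - a (suc j) * q n - b j * p n) (eq (suc n)))
    (solve 6 (λ m w a q b p → m :+ con 1ℚ :* w :- a :* q :- b :* p
        := m :+ con 1ℚ :* (w :+ (:- a) :* q :+ (:- b) :* p)) refl
      (M (suc j) (suc n)) (w (suc n)) (a (suc j)) (q n) (b j) (p n))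
    where
    p = threeTerm a b c j
    q = threeTerm a b c (suc j)
    r : Series
    r n = w (suc n) + - a (suc j) * q n + - b j * p n
    r∈ : Span (Before (suc (suc j))) r
    r∈ = Span-linear (- b j)
      (Span-linear {w = λ n → w (suc n) + - a (suc j) * q n} (- a (suc j)) (shift w∈) (monic⇒span q-monic) λ _ → refl)
      (weaken (monic⇒span p-monic)) λ _ → refl

hankel-det : ∀ a b c n →
  (∀ {i j} → i ℕ.< j → threeTerm a b c j i ≡ 0ℚ) →
  H n c ≡ product {suc n} λ j → threeTerm a b c (toℕ j) (toℕ j)
hankel-det a b c n orthogonal = begin
  det {suc n} (λ i j → c (toℕ i ℕ.+ toℕ j))
    ≡⟨ det-cong {suc n} (λ i j → sym (hankelColumn-+ c (toℕ j) (toℕ i))) ⟩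
  det {suc n} (λ i j → hankelColumn c (toℕ j) (toℕ i))
    ≡⟨ det-unitriangular (suc n) (threeTerm a b c) (hankelColumn c) (threeTerm-monic a b c) ⟨
  det {suc n} (λ i j → threeTerm a b c (toℕ j) (toℕ i))
    ≡⟨ det-lowerTriangular {suc n} (λ i j → threeTerm a b c (toℕ j) (toℕ i)) orthogonal ⟩
  product {suc n} (λ j → threeTerm a b c (toℕ j) (toℕ j)) ∎
  where open ≡-Reasoning

-- Exponential generating functions

toℚᵘ-fromℕ : ∀ n → toℚᵘ (fromℕ n) ℚᵘ.≃ ℚᵘ.mkℚᵘ (ℤ.+ n) 0
toℚᵘ-fromℕ n = toℚᵘ-fromℚᵘ (ℚᵘ.mkℚᵘ (ℤ.+ n) 0)

fromℕ-+ : ∀ m n → fromℕ (m ℕ.+ n) ≡ fromℕ m + fromℕ n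
fromℕ-+ m n = toℚᵘ-injective (begin
  toℚᵘ (fromℕ (m ℕ.+ n))              ≈⟨ toℚᵘ-fromℕ (m ℕ.+ n) ⟩
  ℚᵘ.mkℚᵘ (ℤ.+ (m ℕ.+ n)) 0           ≈⟨ ℚᵘ.*≡* (cong (ℤ._* ℤ.1ℤ) (sym (cong₂ ℤ._+_ (ℤ.*-identityʳ (ℤ.+ m)) (ℤ.*-identityʳ (ℤ.+ n))))) ⟩
  ℚᵘ.mkℚᵘ (ℤ.+ m) 0 ℚᵘ.+ ℚᵘ.mkℚᵘ (ℤ.+ n) 0  ≈⟨ ℚᵘ.+-cong (toℚᵘ-fromℕ m) (toℚᵘ-fromℕ n) ⟨
  toℚᵘ (fromℕ m) ℚᵘ.+ toℚᵘ (fromℕ n)  ≈⟨ toℚᵘ-homo-+ (fromℕ m) (fromℕ n) ⟨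
  toℚᵘ (fromℕ m + fromℕ n)            ∎)
  where open ℚᵘ.≃-Reasoning

fromℕ-* : ∀ m n → fromℕ (m ℕ.* n) ≡ fromℕ m * fromℕ n
fromℕ-* m n = toℚᵘ-injective (begin
  toℚᵘ (fromℕ (m ℕ.* n))              ≈⟨ toℚᵘ-fromℕ (m ℕ.* n) ⟩
  ℚᵘ.mkℚᵘ (ℤ.+ (m ℕ.* n)) 0           ≈⟨ ℚᵘ.*≡* (cong (ℤ._* ℤ.1ℤ) (ℤ.pos-* m n)) ⟩
  ℚᵘ.mkℚᵘ (ℤ.+ m) 0 ℚᵘ.* ℚᵘ.mkℚᵘ (ℤ.+ n) 0  ≈⟨ ℚᵘ.*-cong (toℚᵘ-fromℕ m) (toℚᵘ-fromℕ n) ⟨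
  toℚᵘ (fromℕ m) ℚᵘ.* toℚᵘ (fromℕ n)  ≈⟨ toℚᵘ-homo-* (fromℕ m) (fromℕ n) ⟨
  toℚᵘ (fromℕ m * fromℕ n)            ∎)
  where open ℚᵘ.≃-Reasoning

fromℕ-suc : ∀ n → fromℕ (suc n) ≡ 1ℚ + fromℕ n
fromℕ-suc = fromℕ-+ 1

fromℕ-! : ∀ n → fromℕ (suc n !) ≡ (1ℚ + fromℕ n) * fromℕ (n !)
fromℕ-! n = trans (fromℕ-* (suc n) (n !)) (cong (_* fromℕ (n !)) (fromℕ-suc n))

-- The passage to unnormalised rationals avoids the gcd hidden in `_/_`; later arguments use
-- fractions only through this equation.
/-*-cancel : ∀ m d .{{_ : ℕ.NonZero d}} → (ℤ.+ m / d) * fromℕ d ≡ fromℕ m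
/-*-cancel m d@(suc k) = toℚᵘ-injective (begin
  toℚᵘ ((ℤ.+ m / d) * fromℕ d)                 ≈⟨ toℚᵘ-homo-* (ℤ.+ m / d) (fromℕ d) ⟩
  toℚᵘ (ℤ.+ m / d) ℚᵘ.* toℚᵘ (fromℕ d)         ≈⟨ ℚᵘ.*-cong (toℚᵘ-fromℚᵘ (ℚᵘ.mkℚᵘ (ℤ.+ m) k)) (toℚᵘ-fromℕ d) ⟩
  ℚᵘ.mkℚᵘ (ℤ.+ m) k ℚᵘ.* ℚᵘ.mkℚᵘ (ℤ.+ d) 0     ≈⟨ ℚᵘ.*≡* (ℤ.*-assoc (ℤ.+ m) (ℤ.+ d) ℤ.1ℤ) ⟩
  ℚᵘ.mkℚᵘ (ℤ.+ m) 0                            ≈⟨ toℚᵘ-fromℕ m ⟨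
  toℚᵘ (fromℕ m)                               ∎)
  where open ℚᵘ.≃-Reasoning

!-invFact : ∀ n → fromℕ (n !) * invFact n ≡ 1ℚ
!-invFact n = trans (*-comm (fromℕ (n !)) (invFact n)) (/-*-cancel 1 (n !) {{n ℕ.!≢0}})

invFact-suc : ∀ n → invFact n ≡ (1ℚ + fromℕ n) * invFact (suc n)
invFact-suc n = begin
  p                            ≡⟨ *-identityʳ p ⟨
  p * 1ℚ                       ≡⟨ cong (p *_) (!-invFact (suc n)) ⟨
  p * (fromℕ (suc n !) * q)    ≡⟨ cong (λ x → p * (x * q)) (fromℕ-! n) ⟩
  p * ((1ℚ + fromℕ n) * f * q) ≡⟨ solve 4 (λ p s f q → p :* (s :* f :* q) := f :* p :* (s :* q)) refl p (1ℚ + fromℕ n) f q ⟩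
  f * p * ((1ℚ + fromℕ n) * q) ≡⟨ cong (_* ((1ℚ + fromℕ n) * q)) (!-invFact n) ⟩
  1ℚ * ((1ℚ + fromℕ n) * q)    ≡⟨ *-identityˡ _ ⟩
  (1ℚ + fromℕ n) * q           ∎
  where
  open ≡-Reasoning
  p = invFact n
  q = invFact (suc n)
  f = fromℕ (n !)

-- Products and derivatives of power series

⊛-congˡ : ∀ {f f′} g → f ≗ f′ → f ⊛ g ≗ f′ ⊛ g
⊛-congˡ g eq n = sum-cong-≗ +-0-monoid {suc n} λ i → cong (_* g (n ℕ.∸ toℕ i)) (eq (toℕ i))

⊛-congʳ : ∀ f {g g′} → g ≗ g′ → f ⊛ g ≗ f ⊛ g′
⊛-congʳ f eq n = sum-cong-≗ +-0-monoid {suc n} λ i → cong (f (toℕ i) *_) (eq (n ℕ.∸ toℕ i))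

-- By computation `(f ⊛ h) (suc n)` is `f 0 * h (suc n) + (tail f ⊛ h) n`, so such identities follow
-- by induction on `n` with the left factor replaced by its tail.
⊛-distribʳ : ∀ f g h n → ((λ k → f k + g k) ⊛ h) n ≡ (f ⊛ h) n + (g ⊛ h) n
⊛-distribʳ f g h zero    =
  solve 3 (λ f g h → (f :+ g) :* h :+ con 0ℚ := f :* h :+ con 0ℚ :+ (g :* h :+ con 0ℚ)) refl (f 0) (g 0) (h 0)
⊛-distribʳ f g h (suc n) = trans
  (cong ((f 0 + g 0) * h (suc n) +_) (⊛-distribʳ (tail f) (tail g) h n))
  (solve 5 (λ f g h x y → (f :+ g) :* h :+ (x :+ y) := f :* h :+ x :+ (g :* h :+ y)) refl
    (f 0) (g 0) (h (suc n)) ((tail f ⊛ h) n) ((tail g ⊛ h) n))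

⊛-distribˡ-⊖ : ∀ f g h n → (f ⊛ (g ⊖ h)) n ≡ (f ⊛ g) n - (f ⊛ h) n
⊛-distribˡ-⊖ f g h zero    =
  solve 3 (λ f g h → f :* (g :- h) :+ con 0ℚ := f :* g :+ con 0ℚ :- (f :* h :+ con 0ℚ)) refl (f 0) (g 0) (h 0)
⊛-distribˡ-⊖ f g h (suc n) = trans
  (cong (f 0 * (g (suc n) - h (suc n)) +_) (⊛-distribˡ-⊖ (tail f) g h n))
  (solve 5 (λ f g h x y → f :* (g :- h) :+ (x :- y) := f :* g :+ x :- (f :* h :+ y)) refl
    (f 0) (g (suc n)) (h (suc n)) ((tail f ⊛ g) n) ((tail f ⊛ h) n))

⊛-identityʳ : ∀ f → f ⊛ 𝟙 ≗ f
⊛-identityʳ f zero    = solve 1 (λ x → x :* con 1ℚ :+ con 0ℚ := x) refl (f 0)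
⊛-identityʳ f (suc n) = trans (cong (f 0 * 0ℚ +_) (⊛-identityʳ (tail f) n))
  (solve 2 (λ x y → x :* con 0ℚ :+ y := y) refl (f 0) (f (suc n)))

derivative : Series → Series
derivative f n = (1ℚ + fromℕ n) * f (suc n)

-- The induction hypothesis concerns `tail f`. Shift and derivative do not commute:
-- `tail (derivative f)` exceeds `derivative (tail f)` by `tail (tail f)`, and this absorbs the copy
-- of `tail (tail f) ⊛ g` left over.
leibniz : ∀ f g n → derivative (f ⊛ g) n ≡ (derivative f ⊛ g) n + (f ⊛ derivative g) n
leibniz f g zero = solve 4 (λ f₀ f₁ g₀ g₁ →
    (con 1ℚ :+ con 0ℚ) :* (f₀ :* g₁ :+ (f₁ :* g₀ :+ con 0ℚ))
    := (con 1ℚ :+ con 0ℚ) :* f₁ :* g₀ :+ con 0ℚ :+ (f₀ :* ((con 1ℚ :+ con 0ℚ) :* g₁) :+ con 0ℚ))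
  refl (f 0) (f 1) (g 0) (g 1)
leibniz f g (suc n) = begin
  (1ℚ + fromℕ (suc n)) * (f₀ * g (suc (suc n)) + (tail f ⊛ g) (suc n))
    ≡⟨ cong (λ s → (1ℚ + s) * (f₀ * g (suc (suc n)) + (tail f ⊛ g) (suc n))) (fromℕ-suc n) ⟩
  (1ℚ + s) * (f₀ * g (suc (suc n)) + (f₁ * g (suc n) + z))
    ≡⟨ solve 6 (λ s f₀ f₁ g₂ g₁ z → (con 1ℚ :+ s) :* (f₀ :* g₂ :+ (f₁ :* g₁ :+ z))
         := f₁ :* g₁ :+ z :+ f₀ :* ((con 1ℚ :+ s) :* g₂) :+ s :* (f₁ :* g₁ :+ z)) refl
         s f₀ f₁ (g (suc (suc n))) (g (suc n)) z ⟩
  f₁ * g (suc n) + z + f₀ * ((1ℚ + s) * g (suc (suc n))) + s * (tail f ⊛ g) (suc n)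
    ≡⟨ cong (f₁ * g (suc n) + z + f₀ * ((1ℚ + s) * g (suc (suc n))) +_) (leibniz (tail f) g n) ⟩
  f₁ * g (suc n) + z + f₀ * ((1ℚ + s) * g (suc (suc n))) + (x + y)
    ≡⟨ solve 6 (λ f₁ g₁ z w x y → f₁ :* g₁ :+ z :+ w :+ (x :+ y)
         := (con 1ℚ :* f₁ :* g₁ :+ (x :+ z)) :+ (w :+ y)) refl
         f₁ (g (suc n)) z (f₀ * ((1ℚ + s) * g (suc (suc n)))) x y ⟩
  (1ℚ * f₁ * g (suc n) + (x + z)) + (f₀ * ((1ℚ + s) * g (suc (suc n))) + y)
    ≡⟨ cong₂ (λ p q → (1ℚ * f₁ * g (suc n) + p) + (f₀ * ((1ℚ + q) * g (suc (suc n))) + y))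
         (trans (sym (⊛-distribʳ (derivative (tail f)) (tail (tail f)) g n)) (⊛-congˡ g tail-derivative n))
         (sym (fromℕ-suc n)) ⟩
  (derivative f ⊛ g) (suc n) + (f ⊛ derivative g) (suc n) ∎
  where
  open ≡-Reasoning
  s = 1ℚ + fromℕ n
  f₀ = f 0
  f₁ = f 1
  x = (derivative (tail f) ⊛ g) n
  y = (tail f ⊛ derivative g) n
  z = (tail (tail f) ⊛ g) n
  tail-derivative : ∀ k → derivative (tail f) k + f (suc (suc k)) ≡ derivative f (suc k)
  tail-derivative k = trans
    (solve 2 (λ s x → (con 1ℚ :+ s) :* x :+ x := (con 1ℚ :+ (con 1ℚ :+ s)) :* x) refl (fromℕ k) (f (suc (suc k))))
    (cong (λ s → (1ℚ + s) * f (suc (suc k))) (sym (fromℕ-suc k)))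

-- A sequence w stands for the functional p ↦ p(w) on polynomials with xⁿ ↦ wₙ;
-- translate w is then p ↦ (p(x + 1))(w), and tail w is p ↦ (x p(x))(w).
translate : Series → Series
translate w zero    = w 0
translate w (suc n) = translate (λ k → w (suc k) + w k) n

translate-linear : ∀ {u v w} a → (∀ n → w n ≡ u n + a * v n) →
  ∀ n → translate w n ≡ translate u n + a * translate v n
translate-linear a eq zero    = eq 0
translate-linear {u} {v} a eq (suc n) = translate-linear a (λ k → trans (cong₂ _+_ (eq (suc k)) (eq k))
  (solve 5 (λ u u′ v v′ a → u′ :+ a :* v′ :+ (u :+ a :* v) := u′ :+ u :+ a :* (v′ :+ v)) refl
    (u k) (u (suc k)) (v k) (v (suc k)) a)) n

-- This splits (x + 1)ⁿ⁺¹ into x (x + 1)ⁿ + (x + 1)ⁿ.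
translate-suc : ∀ w n → translate w (suc n) ≡ translate (tail w) n + translate w n
translate-suc w n = trans
  (translate-linear 1ℚ (λ k → cong (w (suc k) +_) (sym (*-identityˡ (w k)))) n)
  (cong (translate (tail w) n +_) (*-identityˡ (translate w n)))

-- Translation and the Bernoulli generating function

egf : Series → Series
egf w n = w n * invFact n

derivative-egf : ∀ w → derivative (egf w) ≗ egf (tail w)
derivative-egf w n = trans
  (solve 3 (λ s w i → s :* (w :* i) := w :* (s :* i)) refl (1ℚ + fromℕ n) (w (suc n)) (invFact (suc n)))
  (cong (w (suc n) *_) (sym (invFact-suc n)))

1^n≡1 : ∀ n → 1ℚ ^ n ≡ 1ℚ
1^n≡1 zero    = refl
1^n≡1 (suc n) = trans (*-identityˡ (1ℚ ^ n)) (1^n≡1 n)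

derivative-exp1 : derivative (exp 1ℚ) ≗ exp 1ℚ
derivative-exp1 n = trans (derivative-egf (1ℚ ^_) n)
  (cong (_* invFact n) (*-identityˡ (1ℚ ^ n)))

1+fromℕ-cancel : ∀ n {p q} → (1ℚ + fromℕ n) * p ≡ (1ℚ + fromℕ n) * q → p ≡ q
1+fromℕ-cancel n {p} {q} eq = begin
  p                    ≡⟨ *-identityˡ p ⟨
  1ℚ * p               ≡⟨ cong (_* p) inverse ⟨
  r * (1ℚ + fromℕ n) * p ≡⟨ *-assoc r (1ℚ + fromℕ n) p ⟩
  r * ((1ℚ + fromℕ n) * p) ≡⟨ cong (r *_) eq ⟩
  r * ((1ℚ + fromℕ n) * q) ≡⟨ *-assoc r (1ℚ + fromℕ n) q ⟨
  r * (1ℚ + fromℕ n) * q ≡⟨ cong (_* q) inverse ⟩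
  1ℚ * q               ≡⟨ *-identityˡ q ⟩
  q                    ∎
  where
  open ≡-Reasoning
  r = ℤ.+ 1 / suc n
  inverse : r * (1ℚ + fromℕ n) ≡ 1ℚ
  inverse = trans (cong (r *_) (sym (fromℕ-suc n))) (/-*-cancel 1 (suc n))

-- The constant terms agree. The derivatives agree by induction, applied to `w` and `tail w`, since
-- e^t is its own derivative; the factor n + 1 is then cancelled.
egf-translate : ∀ w → egf (translate w) ≗ egf w ⊛ exp 1ℚ
egf-translate w zero    = solve 1 (λ x → x :* con 1ℚ := x :* con 1ℚ :* con 1ℚ :+ con 0ℚ) refl (w 0)
egf-translate w (suc n) = 1+fromℕ-cancel n (begin
  derivative (egf (translate w)) n
    ≡⟨ derivative-egf (translate w) n ⟩
  translate w (suc n) * invFact n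
    ≡⟨ cong (_* invFact n) (translate-suc w n) ⟩
  (translate (tail w) n + translate w n) * invFact n
    ≡⟨ *-distribʳ-+ (invFact n) (translate (tail w) n) (translate w n) ⟩
  egf (translate (tail w)) n + egf (translate w) n
    ≡⟨ cong₂ _+_ (egf-translate (tail w) n) (egf-translate w n) ⟩
  (egf (tail w) ⊛ exp 1ℚ) n + (egf w ⊛ exp 1ℚ) n
    ≡⟨ cong₂ _+_ (⊛-congˡ (exp 1ℚ) (derivative-egf w) n) (⊛-congʳ (egf w) derivative-exp1 n) ⟨
  (derivative (egf w) ⊛ exp 1ℚ) n + (egf w ⊛ derivative (exp 1ℚ)) n
    ≡⟨ leibniz (egf w) (exp 1ℚ) n ⟨
  derivative (egf w ⊛ exp 1ℚ) n ∎)
  where open ≡-Reasoning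

-- The functional p ↦ p′(B(½)).
μ : Series
μ zero    = 0ℚ
μ (suc n) = fromℕ (suc n) * B n ½

-- The derivative inside μ becomes a factor t of the generating function, as n / n! = 1 / (n - 1)!.
egf-μ : egf μ ≗ t· λ k → B k ½ * invFact k
egf-μ zero    = refl
egf-μ (suc n) = begin
  fromℕ (suc n) * B n ½ * invFact (suc n)   ≡⟨ cong (λ s → s * B n ½ * invFact (suc n)) (fromℕ-suc n) ⟩
  s * B n ½ * invFact (suc n)               ≡⟨ solve 3 (λ s b i → s :* b :* i := b :* (s :* i)) refl s (B n ½) (invFact (suc n)) ⟩
  B n ½ * (s * invFact (suc n))             ≡⟨ cong (B n ½ *_) (invFact-suc n) ⟨
  B n ½ * invFact n                         ∎
  where
  open ≡-Reasoning
  s = 1ℚ + fromℕ n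

Δμ : Series
Δμ n = translate μ n - μ n

egf-injective : ∀ n {x y} → x * invFact n ≡ y * invFact n → x ≡ y
egf-injective n {x} {y} eq = begin
  x                                 ≡⟨ expand x ⟩
  fromℕ (n !) * (x * invFact n)     ≡⟨ cong (fromℕ (n !) *_) eq ⟩
  fromℕ (n !) * (y * invFact n)     ≡⟨ expand y ⟨
  y                                 ∎
  where
  open ≡-Reasoning
  expand : ∀ x → x ≡ fromℕ (n !) * (x * invFact n)
  expand x = sym (trans
    (solve 3 (λ f x i → f :* (x :* i) := x :* (f :* i)) refl (fromℕ (n !)) x (invFact n))
    (trans (cong (x *_) (!-invFact n)) (*-identityʳ x)))

-- Translation multiplies the generating function by e^t, so the difference multiplies it by e^t -
-- 1, which cancels the Bernoulli denominator.
egf-Δμ : egf Δμ ≗ t· t· exp ½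
egf-Δμ n = begin
  (translate μ n - μ n) * invFact n
    ≡⟨ solve 3 (λ x y i → (x :- y) :* i := x :* i :- y :* i) refl (translate μ n) (μ n) (invFact n) ⟩
  egf (translate μ) n - egf μ n
    ≡⟨ cong₂ _-_ (egf-translate μ n) (sym (⊛-identityʳ (egf μ) n)) ⟩
  (egf μ ⊛ exp 1ℚ) n - (egf μ ⊛ 𝟙) n
    ≡⟨ ⊛-distribˡ-⊖ (egf μ) (exp 1ℚ) 𝟙 n ⟨
  (egf μ ⊛ (exp 1ℚ ⊖ 𝟙)) n
    ≡⟨ ⊛-congˡ (exp 1ℚ ⊖ 𝟙) egf-μ n ⟩
  ((t· (λ k → B k ½ * invFact k)) ⊛ (exp 1ℚ ⊖ 𝟙)) n
    ≡⟨ gf n ⟩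
  (t· t· exp ½) n ∎
  where
  open ≡-Reasoning
  gf : ∀ n → ((t· (λ k → B k ½ * invFact k)) ⊛ (exp 1ℚ ⊖ 𝟙)) n ≡ (t· t· exp ½) n
  gf zero    = refl
  gf (suc n) = trans
    (solve 2 (λ x y → con 0ℚ :* x :+ y := y) refl ((exp 1ℚ ⊖ 𝟙) (suc n)) _)
    (bernoulli-gf ½ n)

-- The functional p ↦ p″(½).
Δμ-formula : ∀ n → Δμ n ≡ fromℕ 4 * (fromℕ n * (fromℕ n - 1ℚ) * ½ ^ n)
-- The factor 4 turns ½ⁿ⁻² into ½ⁿ, so that no exponent has to be truncated for n < 2.
Δμ-formula zero          = egf-injective 0 (egf-Δμ 0)
Δμ-formula (suc zero)    = egf-injective 1 (egf-Δμ 1)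
Δμ-formula (suc (suc n)) = egf-injective (suc (suc n)) (trans (egf-Δμ (suc (suc n))) (begin
  p * invFact n
    ≡⟨ cong (p *_) (invFact-suc n) ⟩
  p * (x * invFact (suc n))
    ≡⟨ cong (λ y → p * (x * y)) (invFact-suc (suc n)) ⟩
  p * (x * ((1ℚ + fromℕ (suc n)) * i))
    ≡⟨ cong (λ y → p * (x * ((1ℚ + y) * i))) (fromℕ-suc n) ⟩
  p * (x * ((1ℚ + x) * i))
    ≡⟨ solve 3 (λ p x i → p :* (x :* ((con 1ℚ :+ x) :* i))
         := con (fromℕ 4) :* ((con 1ℚ :+ x) :* (con 1ℚ :+ x :- con 1ℚ) :* (con ½ :* (con ½ :* p))) :* i) refl p x i ⟩
  fromℕ 4 * ((1ℚ + x) * (1ℚ + x - 1ℚ) * (½ * (½ * p))) * i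
    ≡⟨ cong (λ y → fromℕ 4 * (y * (y - 1ℚ) * (½ * (½ * p))) * i)
         (trans (fromℕ-suc (suc n)) (cong (1ℚ +_) (fromℕ-suc n))) ⟨
  fromℕ 4 * (fromℕ (suc (suc n)) * (fromℕ (suc (suc n)) - 1ℚ) * (½ * (½ * p))) * i ∎))
  where
  open ≡-Reasoning
  p = ½ ^ n
  x = 1ℚ + fromℕ n
  i = invFact (suc (suc n))

-- The functional L on the basis φₖ

-- Multiplication of the functional w by the polynomial j² − (x + s/2)², for s = ±1.
quadratic : ℚ → ℚ → Series → Series
quadratic s j w n = (j * j - ½ * ½) * w n - s * w (suc n) - w (suc (suc n))

quadratic-linear : ∀ s j {u v w} a → (∀ n → w n ≡ u n + a * v n) →
  ∀ n → quadratic s j w n ≡ quadratic s j u n + a * quadratic s j v n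
quadratic-linear s j {u} {v} a eq n = trans
  (cong₂ _-_ (cong₂ (λ x y → (j * j - ½ * ½) * x - s * y) (eq n) (eq (suc n))) (eq (suc (suc n))))
  (solve 9 (λ s q a u₀ u₁ u₂ v₀ v₁ v₂ →
    q :* (u₀ :+ a :* v₀) :- s :* (u₁ :+ a :* v₁) :- (u₂ :+ a :* v₂)
    := q :* u₀ :- s :* u₁ :- u₂ :+ a :* (q :* v₀ :- s :* v₁ :- v₂)) refl
    s (j * j - ½ * ½) a (u n) (u (suc n)) (u (suc (suc n))) (v n) (v (suc n)) (v (suc (suc n))))

quadratic-cong : ∀ s j {u v} → u ≗ v → quadratic s j u ≗ quadratic s j v
quadratic-cong s j eq n =
  cong₂ _-_ (cong₂ (λ x y → (j * j - ½ * ½) * x - s * y) (eq n) (eq (suc n))) (eq (suc (suc n)))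

-- Multiplication by ∏_{j≤k} (j² − (x + s/2)²), for s = ±1.
squareFactors : ℚ → ℕ → Series → Series
squareFactors s zero    w = quadratic s 0ℚ w
squareFactors s (suc k) w = quadratic s (fromℕ (suc k)) (squareFactors s k w)

squareFactors-linear : ∀ s k {u v w} a → (∀ n → w n ≡ u n + a * v n) →
  ∀ n → squareFactors s k w n ≡ squareFactors s k u n + a * squareFactors s k v n
squareFactors-linear s zero    {u} {v} {w} a eq = quadratic-linear s 0ℚ {u} {v} {w} a eq
squareFactors-linear s (suc k) {u} {v} {w} a eq =
  quadratic-linear s (fromℕ (suc k)) {squareFactors s k u} {squareFactors s k v} {squareFactors s k w}
    a (squareFactors-linear s k a eq)

translate-0 : ∀ n → translate (λ _ → 0ℚ) n ≡ 0ℚ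
translate-0 n = trans
  (translate-linear {λ _ → 0ℚ} {λ _ → 0ℚ} (- 1ℚ) (λ _ → refl) n)
  (solve 1 (λ x → x :+ con (- 1ℚ) :* x := con 0ℚ) refl (translate (λ _ → 0ℚ) n))

-- Replacing x by x + 1 turns x - ½ into x + ½.
quadratic-translate : ∀ j w → quadratic (- 1ℚ) j (translate w) ≗ translate (quadratic 1ℚ j w)
quadratic-translate j w n = begin
  p * translate w n - - 1ℚ * translate w (suc n) - translate w (suc (suc n))
    ≡⟨ cong₂ (λ x y → p * translate w n - - 1ℚ * x - y) (translate-suc w n)
         (trans (translate-suc w (suc n)) (cong₂ _+_ (translate-suc (tail w) n) (translate-suc w n))) ⟩
  p * x - - 1ℚ * (y + x) - ((z + y) + (y + x))
    ≡⟨ solve 4 (λ p x y z → p :* x :- con (- 1ℚ) :* (y :+ x) :- ((z :+ y) :+ (y :+ x))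
         := (con 0ℚ :+ p :* x) :+ con (- 1ℚ) :* y :+ con (- 1ℚ) :* z) refl p x y z ⟩
  -- The summand 0 gives the scaled term the shape `u + a * v` that `translate-linear` expects.
  (0ℚ + p * x) + - 1ℚ * y + - 1ℚ * z
    ≡⟨ cong (λ t → (t + p * x) + - 1ℚ * y + - 1ℚ * z) (translate-0 n) ⟨
  (translate (λ _ → 0ℚ) n + p * x) + - 1ℚ * y + - 1ℚ * z
    ≡⟨ cong (λ t → t + - 1ℚ * y + - 1ℚ * z) (translate-linear p (λ _ → refl) n) ⟨
  translate (λ k → 0ℚ + p * w k) n + - 1ℚ * y + - 1ℚ * z
    ≡⟨ cong (_+ - 1ℚ * z) (translate-linear (- 1ℚ) (λ _ → refl) n) ⟨
  translate (λ k → 0ℚ + p * w k + - 1ℚ * w (suc k)) n + - 1ℚ * z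
    ≡⟨ translate-linear (- 1ℚ) (λ k → solve 4 (λ p x y z →
         p :* x :- con 1ℚ :* y :- z := con 0ℚ :+ p :* x :+ con (- 1ℚ) :* y :+ con (- 1ℚ) :* z) refl
         p (w k) (w (suc k)) (w (suc (suc k)))) n ⟨
  translate (quadratic 1ℚ j w) n ∎
  where
  open ≡-Reasoning
  p = j * j - ½ * ½
  x = translate w n
  y = translate (tail w) n
  z = translate (tail (tail w)) n

squareFactors-translate : ∀ k w →
  squareFactors (- 1ℚ) k (translate w) ≗ translate (squareFactors 1ℚ k w)
squareFactors-translate zero    w   = quadratic-translate 0ℚ w
squareFactors-translate (suc k) w n = trans
  (quadratic-cong (- 1ℚ) (fromℕ (suc k)) (squareFactors-translate k w) n)
  (quadratic-translate (fromℕ (suc k)) (squareFactors 1ℚ k w) n)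

-- Multiplication by ∏_{j<k} ((j + ½)² − x²).
halfSquareFactors : ℕ → Series → Series
halfSquareFactors zero    w   = w
halfSquareFactors (suc k) w n =
  (fromℕ k + ½) * (fromℕ k + ½) * halfSquareFactors k w n - halfSquareFactors k w (suc (suc n))

-- Splitting each difference of squares and regrouping the linear factors gives -(x + s/2) (x + s (k
-- + ½)) ∏_{j<k} ((j + ½)² - x²) for s = ±1; the two leftover factors appear multiplied out.
squareFactors-halfSquareFactors : ∀ {s} → s * s ≡ 1ℚ → ∀ k w n →
  squareFactors s k w n ≡ - (halfSquareFactors k w (suc (suc n))
    + s * (1ℚ + fromℕ k) * halfSquareFactors k w (suc n)
    + ½ * (fromℕ k + ½) * halfSquareFactors k w n)
squareFactors-halfSquareFactors {s} s²≡1 zero w n =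
  solve 4 (λ s w₀ w₁ w₂ →
    (con 0ℚ :* con 0ℚ :- con ½ :* con ½) :* w₀ :- s :* w₁ :- w₂
    := :- (w₂ :+ s :* (con 1ℚ :+ con 0ℚ) :* w₁ :+ con ½ :* (con 0ℚ :+ con ½) :* w₀)) refl
    s (w n) (w (suc n)) (w (suc (suc n)))
squareFactors-halfSquareFactors {s} s²≡1 (suc k) w n = begin
  quadratic s (fromℕ (suc k)) (squareFactors s k w) n
    ≡⟨ cong (λ x → quadratic s x (squareFactors s k w) n) (fromℕ-suc k) ⟩
  quadratic s (1ℚ + x) (squareFactors s k w) n
    ≡⟨ quadratic-cong s (1ℚ + x) (squareFactors-halfSquareFactors {s} s²≡1 k w) n ⟩
  ((1ℚ + x) * (1ℚ + x) - ½ * ½) * (- (h 2 + s * (1ℚ + x) * h 1 + ½ * (x + ½) * h 0))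
    - s * (- (h 3 + s * (1ℚ + x) * h 2 + ½ * (x + ½) * h 1))
    - (- (h 4 + s * (1ℚ + x) * h 3 + ½ * (x + ½) * h 2))
    -- For an indeterminate s the two sides differ by a multiple of s² - 1, which is split off here.
    ≡⟨ solve 7 (λ s x h₀ h₁ h₂ h₃ h₄ →
         let half = con ½ ; y = con 1ℚ :+ x ; q = (x :+ half) :* (x :+ half) in
         (y :* y :- half :* half) :* (:- (h₂ :+ s :* y :* h₁ :+ half :* (x :+ half) :* h₀))
           :- s :* (:- (h₃ :+ s :* y :* h₂ :+ half :* (x :+ half) :* h₁))
           :- (:- (h₄ :+ s :* y :* h₃ :+ half :* (x :+ half) :* h₂))
         := (s :* s :- con 1ℚ) :* (y :* h₂) :-
           (q :* h₂ :- h₄ :+ s :* (con 1ℚ :+ y) :* (q :* h₁ :- h₃) :+ half :* (y :+ half) :* (q :* h₀ :- h₂)))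
         refl s x (h 0) (h 1) (h 2) (h 3) (h 4) ⟩
  (s * s - 1ℚ) * ((1ℚ + x) * h 2) - rhs (1ℚ + x)
    ≡⟨ cong₂ (λ t y → (t - 1ℚ) * ((1ℚ + x) * h 2) - rhs y) s²≡1 (sym (fromℕ-suc k)) ⟩
  (1ℚ - 1ℚ) * ((1ℚ + x) * h 2) - rhs (fromℕ (suc k))
    ≡⟨ solve 2 (λ a b → (con 1ℚ :- con 1ℚ) :* a :- b := :- b) refl ((1ℚ + x) * h 2) (rhs (fromℕ (suc k))) ⟩
  - rhs (fromℕ (suc k)) ∎
  where
  open ≡-Reasoning
  x = fromℕ k
  h : ℕ → ℚ
  h i = halfSquareFactors k w (i ℕ.+ n)
  rhs : ℚ → ℚ
  rhs y = halfSquareFactors (suc k) w (suc (suc n))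
    + s * (1ℚ + y) * halfSquareFactors (suc k) w (suc n)
    + ½ * (y + ½) * halfSquareFactors (suc k) w n

-- The factor -(x - ½)² has a double zero at ½, so the second derivative of its product with f is -2
-- f(½) there.
quadratic-Δμ : ∀ n → quadratic (- 1ℚ) 0ℚ Δμ n ≡ - fromℕ 2 * ½ ^ n
quadratic-Δμ n = begin
  (0ℚ * 0ℚ - ½ * ½) * Δμ n - - 1ℚ * Δμ (suc n) - Δμ (suc (suc n))
    ≡⟨ cong₂ _-_ (cong₂ (λ a b → (0ℚ * 0ℚ - ½ * ½) * a - - 1ℚ * b)
         (Δμ-formula n)
         (trans (Δμ-formula (suc n)) (cong (λ y → fromℕ 4 * (y * (y - 1ℚ) * (½ * p))) (fromℕ-suc n))))
         (trans (Δμ-formula (suc (suc n))) (cong (λ y → fromℕ 4 * (y * (y - 1ℚ) * (½ * (½ * p))))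
           (trans (fromℕ-suc (suc n)) (cong (1ℚ +_) (fromℕ-suc n))))) ⟩
  (0ℚ * 0ℚ - ½ * ½) * (fromℕ 4 * (x * (x - 1ℚ) * p))
    - - 1ℚ * (fromℕ 4 * ((1ℚ + x) * (1ℚ + x - 1ℚ) * (½ * p)))
    - fromℕ 4 * ((1ℚ + (1ℚ + x)) * (1ℚ + (1ℚ + x) - 1ℚ) * (½ * (½ * p)))
    ≡⟨ solve 2 (λ x p →
         let o = con 1ℚ ; y = o :+ x ; z = o :+ y ; h = con ½ ; f = con (fromℕ 4) in
         (con 0ℚ :* con 0ℚ :- h :* h) :* (f :* (x :* (x :- o) :* p))
           :- con (- 1ℚ) :* (f :* (y :* (y :- o) :* (h :* p)))
           :- f :* (z :* (z :- o) :* (h :* (h :* p)))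
         := con (- fromℕ 2) :* p) refl x p ⟩
  - fromℕ 2 * p ∎
  where
  open ≡-Reasoning
  x = fromℕ n
  p = ½ ^ n

-- After the double zero has used up both derivatives, every further factor j² - (x - ½)² is
-- evaluated at ½ and contributes j².
squareFactors-Δμ : ∀ k n →
  squareFactors (- 1ℚ) k Δμ n ≡ - fromℕ 2 * (fromℕ (k !) * fromℕ (k !)) * ½ ^ n
squareFactors-Δμ zero n = trans (quadratic-Δμ n)
  (solve 1 (λ p → con (- fromℕ 2) :* p := con (- fromℕ 2) :* (con 1ℚ :* con 1ℚ) :* p) refl (½ ^ n))
squareFactors-Δμ (suc k) n = begin
  quadratic (- 1ℚ) y (squareFactors (- 1ℚ) k Δμ) n
    ≡⟨ quadratic-cong (- 1ℚ) y (squareFactors-Δμ k) n ⟩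
  (y * y - ½ * ½) * (t * (f * f) * p) - - 1ℚ * (t * (f * f) * (½ * p)) - t * (f * f) * (½ * (½ * p))
    ≡⟨ solve 3 (λ y f p → let t = con (- fromℕ 2) ; h = con ½ in
         (y :* y :- h :* h) :* (t :* (f :* f) :* p) :- con (- 1ℚ) :* (t :* (f :* f) :* (h :* p)) :- t :* (f :* f) :* (h :* (h :* p))
         := t :* ((y :* f) :* (y :* f)) :* p) refl y f p ⟩
  t * ((y * f) * (y * f)) * p
    ≡⟨ cong (λ z → t * (z * z) * p) (fromℕ-* (suc k) (k !)) ⟨
  t * (fromℕ (suc k !) * fromℕ (suc k !)) * p ∎
  where
  open ≡-Reasoning
  t = - fromℕ 2
  y = fromℕ (suc k)
  f = fromℕ (k !)
  p = ½ ^ n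

-- With K = ∏_{j≤k} (j² − x²), the difference K(x + ½) − K(x − ½) is
-- −2 (k + 1) x ∏_{j<k} ((j + ½)² − x²), while Δμ sees only K″(0) = −2 k!².
halfSquareFactors-μ : ∀ k →
  (1ℚ + fromℕ k) * halfSquareFactors k μ 1 ≡ fromℕ (k !) * fromℕ (k !)
halfSquareFactors-μ k = begin
  y * h₁
    ≡⟨ solve 4 (λ y h₀ h₁ h₂ →
         y :* h₁ := con (- ½) :* (:- (h₂ :+ con 1ℚ :* y :* h₁ :+ h₀) :+ con (- 1ℚ) :* (:- (h₂ :+ con (- 1ℚ) :* y :* h₁ :+ h₀))))
         refl y h₀ h₁ (halfSquareFactors k μ 2) ⟩
  - ½ * (- (halfSquareFactors k μ 2 + 1ℚ * y * h₁ + h₀) + - 1ℚ * (- (halfSquareFactors k μ 2 + - 1ℚ * y * h₁ + h₀)))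
    ≡⟨ cong₂ (λ a b → - ½ * (a + - 1ℚ * b))
         (squareFactors-halfSquareFactors {1ℚ} refl k μ 0)
         (squareFactors-halfSquareFactors { - 1ℚ} refl k μ 0) ⟨
  - ½ * (squareFactors 1ℚ k μ 0 + - 1ℚ * squareFactors (- 1ℚ) k μ 0)
    ≡⟨ cong (λ a → - ½ * (a + - 1ℚ * squareFactors (- 1ℚ) k μ 0)) (squareFactors-translate k μ 0) ⟨
  - ½ * (squareFactors (- 1ℚ) k (translate μ) 0 + - 1ℚ * squareFactors (- 1ℚ) k μ 0)
    ≡⟨ cong (- ½ *_) (squareFactors-linear (- 1ℚ) k (- 1ℚ)
         (λ n → solve 2 (λ x y → x :- y := x :+ con (- 1ℚ) :* y) refl (translate μ n) (μ n)) 0) ⟨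
  - ½ * squareFactors (- 1ℚ) k Δμ 0
    ≡⟨ cong (- ½ *_) (squareFactors-Δμ k 0) ⟩
  - ½ * (- fromℕ 2 * (f * f) * 1ℚ)
    ≡⟨ solve 1 (λ x → con (- ½) :* (con (- fromℕ 2) :* x :* con 1ℚ) := x) refl (f * f) ⟩
  f * f ∎
  where
  open ≡-Reasoning
  y = 1ℚ + fromℕ k
  f = fromℕ (k !)
  h₁ = halfSquareFactors k μ 1
  h₀ = ½ * (fromℕ k + ½) * halfSquareFactors k μ 0

-- Orthogonality

-- Multiplication of the functional w by ∏_{j<i} ((j + ½)² − z).
wilsonFactors : ℕ → Series → Series
wilsonFactors zero    w   = w
wilsonFactors (suc i) w n = (fromℕ i + ½) * (fromℕ i + ½) * wilsonFactors i w n - wilsonFactors i w (suc n)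

wilsonFactors-tail : ∀ i w → wilsonFactors i (tail w) ≗ tail (wilsonFactors i w)
wilsonFactors-tail zero    w n = refl
wilsonFactors-tail (suc i) w n = cong₂ (λ x y → (fromℕ i + ½) * (fromℕ i + ½) * x - y)
  (wilsonFactors-tail i w n) (wilsonFactors-tail i w (suc n))

wilsonFactors-linear : ∀ i {u v w} a → (∀ n → w n ≡ u n + a * v n) →
  ∀ n → wilsonFactors i w n ≡ wilsonFactors i u n + a * wilsonFactors i v n
wilsonFactors-linear zero    a eq = eq
wilsonFactors-linear (suc i) {u} {v} {w} a eq n = trans
  (cong₂ (λ x y → q * x - y) (wilsonFactors-linear i {u} {v} {w} a eq n) (wilsonFactors-linear i {u} {v} {w} a eq (suc n)))
  (solve 6 (λ q a u₀ u₁ v₀ v₁ → q :* (u₀ :+ a :* v₀) :- (u₁ :+ a :* v₁)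
    := q :* u₀ :- u₁ :+ a :* (q :* v₀ :- v₁)) refl
    q a (wilsonFactors i u n) (wilsonFactors i u (suc n)) (wilsonFactors i v n) (wilsonFactors i v (suc n)))
  where q = (fromℕ i + ½) * (fromℕ i + ½)

-- From z φᵢ = (i + ½)² φᵢ - φᵢ₊₁ it follows that zᵏ φᵢ is (-1)ᵏ φₖ₊ᵢ plus a combination of φₗ with
-- l < k + i, on which `w` vanishes.
wilsonFactors-vanish : ∀ w k i → (∀ l → l ℕ.< k ℕ.+ i → wilsonFactors l w 0 ≡ 0ℚ) →
  wilsonFactors i w k ≡ (- 1ℚ) ^ k * wilsonFactors (k ℕ.+ i) w 0
wilsonFactors-vanish w zero    i _ = sym (*-identityˡ _)
wilsonFactors-vanish w (suc k) i w≡0 = begin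
  v                          ≡⟨ solve 2 (λ x v → v := x :- (x :- v)) refl (q * wilsonFactors i w k) v ⟩
  q * wilsonFactors i w k - wilsonFactors (suc i) w k
    ≡⟨ cong₂ (λ x y → q * x - y)
         (trans (wilsonFactors-vanish w k i (λ l l< → w≡0 l (ℕ.m≤n⇒m≤1+n l<))) (cong ((- 1ℚ) ^ k *_) (w≡0 (k ℕ.+ i) (ℕ.n<1+n _))))
         (wilsonFactors-vanish w k (suc i) (λ l l< → w≡0 l (subst (l ℕ.<_) (ℕ.+-suc k i) l<))) ⟩
  q * (s * 0ℚ) - s * wilsonFactors (k ℕ.+ suc i) w 0
    ≡⟨ cong (λ m → q * (s * 0ℚ) - s * wilsonFactors m w 0) (ℕ.+-suc k i) ⟩
  q * (s * 0ℚ) - s * z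
    ≡⟨ solve 3 (λ q s z → q :* (s :* con 0ℚ) :- s :* z := con (- 1ℚ) :* s :* z) refl q s z ⟩
  - 1ℚ * s * z ∎
  where
  open ≡-Reasoning
  q = (fromℕ i + ½) * (fromℕ i + ½)
  s = (- 1ℚ) ^ k
  v = wilsonFactors i w (suc k)
  z = wilsonFactors (suc (k ℕ.+ i)) w 0

wilsonFactors-triangular : ∀ w k → (∀ l → l ℕ.< k → wilsonFactors l w 0 ≡ 0ℚ) →
  w k ≡ (- 1ℚ) ^ k * wilsonFactors k w 0
wilsonFactors-triangular w k w≡0 = trans
  (wilsonFactors-vanish w k 0 (λ l l< → w≡0 l (subst (l ℕ.<_) (ℕ.+-identityʳ k) l<)))
  (cong (λ m → (- 1ℚ) ^ k * wilsonFactors m w 0) (ℕ.+-identityʳ k))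

moments : Series
moments k = fromℕ (2 ℕ.* k ℕ.+ 1) * B (2 ℕ.* k) ½

moments-μ : ∀ k → moments k ≡ μ (suc (2 ℕ.* k))
moments-μ k = cong (λ m → fromℕ m * B (2 ℕ.* k) ½) (ℕ.+-comm (2 ℕ.* k) 1)

-- The substitution z = x²: each zⁿ becomes x²ⁿ⁺¹ because of the extra factor x in L(q) = μ(x
-- q(x²)).
wilsonFactors-halfSquareFactors : ∀ i n →
  wilsonFactors i moments n ≡ halfSquareFactors i μ (suc (2 ℕ.* n))
wilsonFactors-halfSquareFactors zero    n = moments-μ n
wilsonFactors-halfSquareFactors (suc i) n = cong₂ (λ x y → (fromℕ i + ½) * (fromℕ i + ½) * x - y)
  (wilsonFactors-halfSquareFactors i n)
  (trans (wilsonFactors-halfSquareFactors i (suc n))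
    (cong (halfSquareFactors i μ ∘ suc) (ℕ.*-suc 2 n)))

-- The value i!² / (i + 1) is written as i!³ / (i + 1)!, the shape that `pairing` generalises to all
-- j.
wilsonFactors-moments : ∀ i → wilsonFactors i moments 0 ≡
  fromℕ (i !) * fromℕ (i !) * fromℕ (i !) * invFact (suc i)
wilsonFactors-moments i = begin
  h                               ≡⟨ wilsonFactors-halfSquareFactors i 0 ⟩
  halfSquareFactors i μ 1         ≡⟨ *-identityʳ g ⟨
  g * 1ℚ                          ≡⟨ cong (g *_) (!-invFact i) ⟨
  g * (f * invFact i)             ≡⟨ cong (λ y → g * (f * y)) (invFact-suc i) ⟩
  g * (f * (x * invFact (suc i))) ≡⟨ solve 4 (λ g f x v → g :* (f :* (x :* v)) := x :* g :* f :* v) refl g f x (invFact (suc i)) ⟩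
  x * g * f * invFact (suc i)     ≡⟨ cong (λ y → y * f * invFact (suc i)) (halfSquareFactors-μ i) ⟩
  f * f * f * invFact (suc i)     ∎
  where
  open ≡-Reasoning
  h = wilsonFactors i moments 0
  g = halfSquareFactors i μ 1
  f = fromℕ (i !)
  x = 1ℚ + fromℕ i

-- Closed form of the pairings L(φᵢ pⱼ)

falling : ℕ → ℕ → ℚ
falling i zero    = 1ℚ
falling i (suc j) = falling i j * (fromℕ i - fromℕ j)

falling-suc : ∀ i j → falling (suc i) (suc j) ≡ (1ℚ + fromℕ i) * falling i j
falling-suc i zero    = trans (cong (λ y → 1ℚ * (y - 0ℚ)) (fromℕ-suc i))
  (solve 1 (λ x → con 1ℚ :* (x :- con 0ℚ) := x :* con 1ℚ) refl (1ℚ + fromℕ i))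
falling-suc i (suc j) = trans
  (cong₂ _*_ (falling-suc i j) (cong₂ _-_ (fromℕ-suc i) (fromℕ-suc j)))
  (solve 3 (λ x y u → (con 1ℚ :+ x) :* u :* (con 1ℚ :+ x :- (con 1ℚ :+ y))
    := (con 1ℚ :+ x) :* (u :* (x :- y))) refl (fromℕ i) (fromℕ j) (falling i j))

falling-< : ∀ {i j} → i ℕ.< j → falling i j ≡ 0ℚ
falling-< {zero}  {suc zero}    (ℕ.s≤s ℕ.z≤n) = refl
falling-< {zero}  {suc (suc j)} (ℕ.s≤s ℕ.z≤n) = trans
  (cong (_* (0ℚ - fromℕ (suc j))) (falling-< {0} {suc j} (ℕ.s≤s ℕ.z≤n)))
  (*-zeroˡ (0ℚ - fromℕ (suc j)))
falling-< {suc i} {suc j}       (ℕ.s≤s i<j)   = trans (falling-suc i j)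
  (trans (cong ((1ℚ + fromℕ i) *_) (falling-< i<j)) (*-zeroʳ (1ℚ + fromℕ i)))

falling-diagonal : ∀ j → falling j j ≡ fromℕ (j !)
falling-diagonal zero    = refl
falling-diagonal (suc j) = trans (falling-suc j j)
  (trans (cong ((1ℚ + fromℕ j) *_) (falling-diagonal j)) (sym (fromℕ-! j)))

oddRecip : ℕ → ℚ
oddRecip j = ℤ.+ 1 / suc (2 ℕ.* j)

oddRecip-inverse : ∀ j → oddRecip j * (1ℚ + fromℕ 2 * fromℕ j) ≡ 1ℚ
oddRecip-inverse j = trans
  (cong (oddRecip j *_) (sym (trans (fromℕ-suc (2 ℕ.* j)) (cong (1ℚ +_) (fromℕ-* 2 j)))))
  (/-*-cancel 1 (suc (2 ℕ.* j)))

_² _³ _⁶ : ℚ → ℚ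
x ² = x * x
x ³ = x * x * x
x ⁶ = x ³ * x ³

-- The recurrence coefficients Aⱼ + Cⱼ − ¼ = −αⱼ and Aⱼ Cⱼ₊₁ = βⱼ of the monic
-- Wilson polynomials, with Aⱼ = (j+1)³ / (2 (2j+1)) and Cⱼ = j³ / (2 (2j+1)).
α β : Series
α j = - (½ * ½) * (fromℕ 2 * (fromℕ j * fromℕ j) + fromℕ 2 * fromℕ j + 1ℚ)
β j = ½ * ½ * (1ℚ + fromℕ j) ⁶ * (oddRecip j * oddRecip (suc j))

-- The normalising constant (-1)ʲ A₀ ⋯ Aⱼ₋₁.
κ : ℕ → ℚ
κ zero    = 1ℚ
κ (suc j) = - ½ * (1ℚ + fromℕ j) ³ * oddRecip j * κ j

p : ℕ → Series
p = threeTerm α β moments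

-- The product form of L(φᵢ pⱼ); its factor `falling i j` carries the orthogonality.
pairing : ℕ → ℕ → ℚ
pairing i j = κ j * fromℕ (i !) ³ * falling i j * invFact (suc (i ℕ.+ j))

-- The coefficient recursion behind the orthogonality, cleared of the common
-- factor; r stands for 1 / (2 y + 3).
recurrence-core : ∀ x y r → r * (1ℚ + fromℕ 2 * (1ℚ + y)) ≡ 1ℚ →
  - ½ * (1ℚ + (1ℚ + y)) ³ * r * ((x - y) * (x - (1ℚ + y)))
    ≡ ((x + ½) ² + ½ * ½ * (fromℕ 2 * ((1ℚ + y) * (1ℚ + y)) + fromℕ 2 * (1ℚ + y) + 1ℚ))
        * ((x - y) * (1ℚ + (1ℚ + (1ℚ + (x + y)))))
      - (1ℚ + x) ² * (1ℚ + x) ²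
      + ½ * (1ℚ + y) ³ * r * ((1ℚ + (1ℚ + (x + y))) * (1ℚ + (1ℚ + (1ℚ + (x + y)))))
recurrence-core x y r eq = begin
  - ½ * (1ℚ + (1ℚ + y)) ³ * r * ((x - y) * (x - (1ℚ + y)))
    -- The terms free of r are multiplied by r (2 y + 3) = 1, which makes this an identity of
    -- polynomials.
    ≡⟨ solve 3 (λ x y r →
         let o = con 1ℚ ; h = con ½ ; t = con (fromℕ 2) ; z = o :+ y ; w = x :+ y in
         con (- ½) :* ((o :+ z) :* (o :+ z) :* (o :+ z)) :* r :* ((x :- y) :* (x :- z))
         := r :* (o :+ t :* z) :* (((x :+ h) :* (x :+ h) :+ h :* h :* (t :* (z :* z) :+ t :* z :+ o))
                :* ((x :- y) :* (o :+ (o :+ (o :+ w)))) :- (o :+ x) :* (o :+ x) :* ((o :+ x) :* (o :+ x)))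
            :+ h :* (z :* z :* z) :* r :* ((o :+ (o :+ w)) :* (o :+ (o :+ (o :+ w))))) refl x y r ⟩
  r * (1ℚ + fromℕ 2 * (1ℚ + y)) * g + rest
    ≡⟨ cong (λ t → t * g + rest) eq ⟩
  1ℚ * g + rest
    ≡⟨ cong (_+ rest) (*-identityˡ g) ⟩
  g + rest ∎
  where
  open ≡-Reasoning
  g = ((x + ½) ² + ½ * ½ * (fromℕ 2 * ((1ℚ + y) * (1ℚ + y)) + fromℕ 2 * (1ℚ + y) + 1ℚ))
        * ((x - y) * (1ℚ + (1ℚ + (1ℚ + (x + y)))))
      - (1ℚ + x) ² * (1ℚ + x) ²
  rest = ½ * (1ℚ + y) ³ * r * ((1ℚ + (1ℚ + (x + y))) * (1ℚ + (1ℚ + (1ℚ + (x + y)))))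

invFact-+ : ∀ i j → invFact (suc (i ℕ.+ j)) ≡ (1ℚ + (1ℚ + (fromℕ i + fromℕ j))) * invFact (suc (suc (i ℕ.+ j)))
invFact-+ i j = trans (invFact-suc (suc (i ℕ.+ j)))
  (cong (λ y → (1ℚ + y) * invFact (suc (suc (i ℕ.+ j))))
    (trans (fromℕ-suc (i ℕ.+ j)) (cong (1ℚ +_) (fromℕ-+ i j))))

-- This is L(φᵢ p₁) for p₁ = (z - α₀) p₀ with z φᵢ rewritten as (i + ½)² φᵢ - φᵢ₊₁. It stands apart
-- because p₀ has no predecessor.
pairing-1 : ∀ i → pairing i 1 ≡
  (fromℕ i + ½) ² * pairing i 0 - pairing (suc i) 0 - α 0 * pairing i 0
pairing-1 i = begin
  κ 1 * f ³ * (1ℚ * (x - 0ℚ)) * invFact (suc (i ℕ.+ 1))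
    ≡⟨ cong (λ m → κ 1 * f ³ * (1ℚ * (x - 0ℚ)) * invFact (suc m)) (ℕ.+-suc i 0) ⟩
  κ 1 * f ³ * (1ℚ * (x - 0ℚ)) * v
    ≡⟨ solve 3 (λ x f v →
         let o = con 1ℚ ; h = con ½ ; z = con 0ℚ ; s = (o :+ (o :+ (x :+ z))) :* v ; f₁ = (o :+ x) :* f in
         con (κ 1) :* (f :* f :* f) :* (o :* (x :- z)) :* v
         := (x :+ h) :* (x :+ h) :* (o :* (f :* f :* f) :* o :* s)
            :- o :* (f₁ :* f₁ :* f₁) :* o :* v
            :- con (α 0) :* (o :* (f :* f :* f) :* o :* s)) refl x f v ⟩
  (x + ½) ² * (1ℚ * f ³ * 1ℚ * ((1ℚ + (1ℚ + (x + 0ℚ))) * v))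
    - 1ℚ * ((1ℚ + x) * f) ³ * 1ℚ * v
    - α 0 * (1ℚ * f ³ * 1ℚ * ((1ℚ + (1ℚ + (x + 0ℚ))) * v))
    ≡⟨ cong₂ (λ s g → (x + ½) ² * (1ℚ * f ³ * 1ℚ * s) - 1ℚ * g ³ * 1ℚ * v - α 0 * (1ℚ * f ³ * 1ℚ * s))
         (invFact-+ i 0) (fromℕ-! i) ⟨
  (x + ½) ² * pairing i 0 - pairing (suc i) 0 - α 0 * pairing i 0 ∎
  where
  open ≡-Reasoning
  x = fromℕ i
  f = fromℕ (i !)
  v = invFact (suc (suc (i ℕ.+ 0)))

-- All terms are multiples of κⱼ₊₁ i!³ `falling i j` / (i + j + 3)!; the cofactors satisfy
-- `recurrence-core`.
pairing-suc-suc : ∀ i j → pairing i (suc (suc j)) ≡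
  (fromℕ i + ½) ² * pairing i (suc j) - pairing (suc i) (suc j)
    - α (suc j) * pairing i (suc j) - β j * pairing i j
pairing-suc-suc i j = begin
  - ½ * (1ℚ + fromℕ (suc j)) ³ * r₁ * κ₁ * f ³ * (u * (x - y) * (x - fromℕ (suc j))) * invFact (suc (i ℕ.+ suc (suc j)))
    ≡⟨ cong₂ (λ z m → - ½ * (1ℚ + z) ³ * r₁ * κ₁ * f ³ * (u * (x - y) * (x - z)) * invFact (suc m))
         (fromℕ-suc j) (trans (ℕ.+-suc i (suc j)) (cong suc (ℕ.+-suc i j))) ⟩
  - ½ * (1ℚ + (1ℚ + y)) ³ * r₁ * κ₁ * f ³ * (u * (x - y) * (x - (1ℚ + y))) * v
    ≡⟨ solve 8 (λ a r k g u b c v → a :* r :* k :* g :* (u :* b :* c) :* v := k :* g :* u :* v :* (a :* r :* (b :* c))) refl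
         (- ½ * (1ℚ + (1ℚ + y)) ³) r₁ κ₁ (f ³) u (x - y) (x - (1ℚ + y)) v ⟩
  κ₁ * f ³ * u * v * (- ½ * (1ℚ + (1ℚ + y)) ³ * r₁ * ((x - y) * (x - (1ℚ + y))))
    ≡⟨ cong (κ₁ * f ³ * u * v *_) (recurrence-core x y r₁
         (trans (cong (λ z → r₁ * (1ℚ + fromℕ 2 * z)) (sym (fromℕ-suc j))) (oddRecip-inverse (suc j)))) ⟩
  κ₁ * f ³ * u * v * (((x + ½) ² + a) * ((x - y) * n₃) - (1ℚ + x) ² * (1ℚ + x) ² + ½ * (1ℚ + y) ³ * r₁ * (n₂ * n₃))
    -- Unfolding κⱼ₊₁ into κⱼ is what makes βⱼ appear in the last term.
    ≡⟨ solve 13 (λ c r r₁ k f u v q a d n₂ n₃ z →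
         let k₁ = con (- ½) :* (c :* c :* c) :* r :* k ; f³ = f :* f :* f ; z³f³ = (z :* f) :* (z :* f) :* (z :* f)
             h = con ½ ; c³ = c :* c :* c in
         k₁ :* f³ :* u :* v :* ((q :+ a) :* (d :* n₃) :- z :* z :* (z :* z) :+ h :* c³ :* r₁ :* (n₂ :* n₃))
         := q :* (k₁ :* f³ :* (u :* d) :* (n₃ :* v)) :- k₁ :* z³f³ :* (z :* u) :* v
            :- (:- a) :* (k₁ :* f³ :* (u :* d) :* (n₃ :* v))
            :- h :* h :* (c³ :* c³) :* (r :* r₁) :* (k :* f³ :* u :* (n₂ :* (n₃ :* v)))) refl
         (1ℚ + y) r r₁ (κ j) f u v ((x + ½) ²) a (x - y) n₂ n₃ (1ℚ + x) ⟩
  (x + ½) ² * (κ₁ * f ³ * (u * (x - y)) * (n₃ * v)) - κ₁ * ((1ℚ + x) * f) ³ * ((1ℚ + x) * u) * v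
    - (- a) * (κ₁ * f ³ * (u * (x - y)) * (n₃ * v))
    - β j * (κ j * f ³ * u * (n₂ * (n₃ * v)))
    ≡⟨ cong (λ b → (x + ½) ² * (κ₁ * f ³ * (u * (x - y)) * (n₃ * v)) - κ₁ * ((1ℚ + x) * f) ³ * ((1ℚ + x) * u) * v
         - b * (κ₁ * f ³ * (u * (x - y)) * (n₃ * v)) - β j * (κ j * f ³ * u * (n₂ * (n₃ * v)))) α-eq ⟨
  (x + ½) ² * (κ₁ * f ³ * (u * (x - y)) * (n₃ * v)) - κ₁ * ((1ℚ + x) * f) ³ * ((1ℚ + x) * u) * v
    - α (suc j) * (κ₁ * f ³ * (u * (x - y)) * (n₃ * v))
    - β j * (κ j * f ³ * u * (n₂ * (n₃ * v)))
    ≡⟨ cong₂ _-_ (cong₂ _-_ (cong₂ _-_ (cong ((x + ½) ² *_) (sym i,j+1)) (sym i+1,j+1)) (cong (α (suc j) *_) (sym i,j+1)))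
         (cong (β j *_) (sym i,j)) ⟩
  (x + ½) ² * pairing i (suc j) - pairing (suc i) (suc j)
    - α (suc j) * pairing i (suc j) - β j * pairing i j ∎
  where
  open ≡-Reasoning
  x = fromℕ i
  y = fromℕ j
  f = fromℕ (i !)
  u = falling i j
  r = oddRecip j
  r₁ = oddRecip (suc j)
  κ₁ = κ (suc j)
  -- The common denominator is (i + j + 3)!; `n₂` and `n₃` are i + j + 2 and i + j + 3.
  v = invFact (suc (suc (suc (i ℕ.+ j))))
  n₂ = 1ℚ + (1ℚ + (x + y))
  n₃ = 1ℚ + n₂
  a = ½ * ½ * (fromℕ 2 * ((1ℚ + y) * (1ℚ + y)) + fromℕ 2 * (1ℚ + y) + 1ℚ)

  α-eq : α (suc j) ≡ - a
  α-eq = trans (cong (λ z → - (½ * ½) * (fromℕ 2 * (z * z) + fromℕ 2 * z + 1ℚ)) (fromℕ-suc j))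
    (sym (neg-distribˡ-* (½ * ½) (fromℕ 2 * ((1ℚ + y) * (1ℚ + y)) + fromℕ 2 * (1ℚ + y) + 1ℚ)))

  invFact-n₃ : invFact (suc (suc (i ℕ.+ j))) ≡ n₃ * v
  invFact-n₃ = trans (invFact-suc (suc (suc (i ℕ.+ j)))) (cong (λ z → (1ℚ + z) * v)
    (trans (fromℕ-suc (suc (i ℕ.+ j))) (cong (1ℚ +_) (trans (fromℕ-suc (i ℕ.+ j)) (cong (1ℚ +_) (fromℕ-+ i j))))))

  i,j : pairing i j ≡ κ j * f ³ * u * (n₂ * (n₃ * v))
  i,j = cong (κ j * f ³ * u *_) (trans (invFact-+ i j) (cong (n₂ *_) invFact-n₃))

  i,j+1 : pairing i (suc j) ≡ κ₁ * f ³ * (u * (x - y)) * (n₃ * v)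
  i,j+1 = cong (κ₁ * f ³ * (u * (x - y)) *_) (trans (cong (invFact ∘ suc) (ℕ.+-suc i j)) invFact-n₃)

  i+1,j+1 : pairing (suc i) (suc j) ≡ κ₁ * ((1ℚ + x) * f) ³ * ((1ℚ + x) * u) * v
  i+1,j+1 = trans (cong₂ (λ g h → κ₁ * g ³ * h * invFact (suc (suc i ℕ.+ suc j))) (fromℕ-! i) (falling-suc i j))
    (cong (λ m → κ₁ * ((1ℚ + x) * f) ³ * ((1ℚ + x) * u) * invFact (suc (suc m))) (ℕ.+-suc i j))

wilsonFactors-tail-0 : ∀ i w → wilsonFactors i (tail w) 0 ≡
  (fromℕ i + ½) ² * wilsonFactors i w 0 - wilsonFactors (suc i) w 0
wilsonFactors-tail-0 i w = trans (wilsonFactors-tail i w 0)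
  (solve 2 (λ x v → v := x :- (x :- v)) refl ((fromℕ i + ½) ² * wilsonFactors i w 0) (wilsonFactors i w 1))

-- Both sides satisfy the same recurrence in j and agree at j = 0. The index i stays general because
-- multiplication by z leads from φᵢ to φᵢ₊₁.
wilsonFactors-p : ∀ j i → wilsonFactors i (p j) 0 ≡ pairing i j
wilsonFactors-p zero i = trans (wilsonFactors-moments i) (trans
  (solve 2 (λ f v → f :* f :* f :* v := con 1ℚ :* (f :* f :* f) :* con 1ℚ :* v) refl (fromℕ (i !)) (invFact (suc i)))
  (cong (λ m → 1ℚ * fromℕ (i !) ³ * 1ℚ * invFact (suc m)) (sym (ℕ.+-identityʳ i))))
wilsonFactors-p (suc zero) i = begin
  wilsonFactors i (p 1) 0
    ≡⟨ wilsonFactors-linear i {tail (p 0)} {p 0} {p 1} (- α 0)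
         (λ n → cong (p 0 (suc n) +_) (neg-distribˡ-* (α 0) (p 0 n))) 0 ⟩
  wilsonFactors i (tail (p 0)) 0 + - α 0 * wilsonFactors i (p 0) 0
    ≡⟨ cong (_+ - α 0 * wilsonFactors i (p 0) 0) (wilsonFactors-tail-0 i (p 0)) ⟩
  (fromℕ i + ½) ² * wilsonFactors i (p 0) 0 - wilsonFactors (suc i) (p 0) 0 + - α 0 * wilsonFactors i (p 0) 0
    ≡⟨ cong₂ (λ x y → (fromℕ i + ½) ² * x - y + - α 0 * x) (wilsonFactors-p 0 i) (wilsonFactors-p 0 (suc i)) ⟩
  (fromℕ i + ½) ² * pairing i 0 - pairing (suc i) 0 + - α 0 * pairing i 0
    ≡⟨ cong ((fromℕ i + ½) ² * pairing i 0 - pairing (suc i) 0 +_) (sym (neg-distribˡ-* (α 0) (pairing i 0))) ⟩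
  (fromℕ i + ½) ² * pairing i 0 - pairing (suc i) 0 - α 0 * pairing i 0
    ≡⟨ pairing-1 i ⟨
  pairing i 1 ∎
  where open ≡-Reasoning
wilsonFactors-p (suc (suc j)) i = begin
  wilsonFactors i (p (suc (suc j))) 0
    ≡⟨ wilsonFactors-linear i {w} {p j} {p (suc (suc j))} (- β j)
         (λ n → solve 5 (λ q′ a q b p → q′ :- a :* q :- b :* p := q′ :+ (:- a) :* q :+ (:- b) :* p) refl
           (q (suc n)) (α (suc j)) (q n) (β j) (p j n)) 0 ⟩
  wilsonFactors i w 0 + - β j * wilsonFactors i (p j) 0
    ≡⟨ cong (_+ - β j * wilsonFactors i (p j) 0)
         (wilsonFactors-linear i {tail q} {q} {w} (- α (suc j)) (λ _ → refl) 0) ⟩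
  wilsonFactors i (tail q) 0 + - α (suc j) * wilsonFactors i q 0 + - β j * wilsonFactors i (p j) 0
    ≡⟨ cong (λ x → x + - α (suc j) * wilsonFactors i q 0 + - β j * wilsonFactors i (p j) 0) (wilsonFactors-tail-0 i q) ⟩
  (fromℕ i + ½) ² * wilsonFactors i q 0 - wilsonFactors (suc i) q 0
    + - α (suc j) * wilsonFactors i q 0 + - β j * wilsonFactors i (p j) 0
    ≡⟨ cong₂ _+_ (cong₂ (λ x y → (fromℕ i + ½) ² * x - y + - α (suc j) * x)
         (wilsonFactors-p (suc j) i) (wilsonFactors-p (suc j) (suc i)))
         (cong (- β j *_) (wilsonFactors-p j i)) ⟩
  (fromℕ i + ½) ² * pairing i (suc j) - pairing (suc i) (suc j)
    + - α (suc j) * pairing i (suc j) + - β j * pairing i j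
    ≡⟨ solve 5 (λ x a q b p → x :+ (:- a) :* q :+ (:- b) :* p := x :- a :* q :- b :* p) refl
         ((fromℕ i + ½) ² * pairing i (suc j) - pairing (suc i) (suc j)) (α (suc j)) (pairing i (suc j)) (β j) (pairing i j) ⟩
  (fromℕ i + ½) ² * pairing i (suc j) - pairing (suc i) (suc j)
    - α (suc j) * pairing i (suc j) - β j * pairing i j
    ≡⟨ pairing-suc-suc i j ⟨
  pairing i (suc (suc j)) ∎
  where
  open ≡-Reasoning
  q w : Series
  q = p (suc j)
  w n = q (suc n) + - α (suc j) * q n

pairing-< : ∀ {i j} → i ℕ.< j → pairing i j ≡ 0ℚ
pairing-< {i} {j} i<j = trans
  (cong (λ u → κ j * fromℕ (i !) ³ * u * invFact (suc (i ℕ.+ j))) (falling-< i<j))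
  (solve 2 (λ x y → x :* con 0ℚ :* y := con 0ℚ) refl (κ j * fromℕ (i !) ³) (invFact (suc (i ℕ.+ j))))

-- Up to the sign (-1)ⁱ, zⁱ is φᵢ plus a combination of φₗ with l < i ≤ j, and these are orthogonal
-- to pⱼ. The range includes the diagonal.
p-triangular : ∀ {i j} → i ℕ.≤ j → p j i ≡ (- 1ℚ) ^ i * pairing i j
p-triangular {i} {j} i≤j = trans
  (wilsonFactors-triangular (p j) i λ l l<i → trans (wilsonFactors-p j l) (pairing-< (ℕ.<-≤-trans l<i i≤j)))
  (cong ((- 1ℚ) ^ i *_) (wilsonFactors-p j i))

p-orthogonal : ∀ {i j} → i ℕ.< j → p j i ≡ 0ℚ
p-orthogonal {i} {j} i<j = trans (p-triangular (ℕ.<⇒≤ i<j))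
  (trans (cong ((- 1ℚ) ^ i *_) (pairing-< i<j)) (*-zeroʳ ((- 1ℚ) ^ i)))

-- Diagonal entries and the determinant

κ-closed : ∀ j → κ j ≡ (- 1ℚ) ^ j * (fromℕ (j !) ² * fromℕ (j !) ²) * invFact (2 ℕ.* j)
κ-closed zero    = refl
κ-closed (suc j) = begin
  - ½ * y ³ * r * κ j
    ≡⟨ cong (- ½ * y ³ * r *_) (κ-closed j) ⟩
  - ½ * y ³ * r * (s * (f ² * f ²) * invFact (2 ℕ.* j))
    ≡⟨ cong (λ i → - ½ * y ³ * r * (s * (f ² * f ²) * i)) (invFact-suc (2 ℕ.* j)) ⟩
  - ½ * y ³ * r * (s * (f ² * f ²) * ((1ℚ + d) * invFact (suc (2 ℕ.* j))))
    ≡⟨ cong₂ (λ d i → - ½ * y ³ * r * (s * (f ² * f ²) * ((1ℚ + d) * i)))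
         (fromℕ-* 2 j) (trans (invFact-suc (suc (2 ℕ.* j)))
           (cong (λ z → (1ℚ + z) * v) (trans (fromℕ-suc (2 ℕ.* j)) (cong (λ z → 1ℚ + z) (fromℕ-* 2 j))))) ⟩
  - ½ * y ³ * r * (s * (f ² * f ²) * ((1ℚ + fromℕ 2 * x) * ((1ℚ + (1ℚ + fromℕ 2 * x)) * v)))
    -- Of the two new factors of (2 j + 2)!, 2 j + 1 is kept to cancel `r`, while 2 (j + 1) absorbs
    -- the ½ and completes (j + 1)³ to a fourth power.
    ≡⟨ solve 5 (λ x r s f v →
         let o = con 1ℚ ; t = con (fromℕ 2) ; y = o :+ x ; f₁ = y :* f in
         con (- ½) :* (y :* y :* y) :* r :* (s :* (f :* f :* (f :* f)) :* ((o :+ t :* x) :* ((o :+ (o :+ t :* x)) :* v)))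
         := r :* (o :+ t :* x) :* (con (- 1ℚ) :* s :* (f₁ :* f₁ :* (f₁ :* f₁)) :* v)) refl x r s f v ⟩
  r * (1ℚ + fromℕ 2 * x) * (- 1ℚ * s * ((y * f) ² * (y * f) ²) * v)
    ≡⟨ cong (_* (- 1ℚ * s * ((y * f) ² * (y * f) ²) * v)) (oddRecip-inverse j) ⟩
  1ℚ * (- 1ℚ * s * ((y * f) ² * (y * f) ²) * v)
    ≡⟨ *-identityˡ _ ⟩
  - 1ℚ * s * ((y * f) ² * (y * f) ²) * v
    ≡⟨ cong₂ (λ f i → - 1ℚ * s * (f ² * f ²) * i) (fromℕ-! j) (cong invFact (ℕ.*-suc 2 j)) ⟨
  - 1ℚ * s * (fromℕ (suc j !) ² * fromℕ (suc j !) ²) * invFact (2 ℕ.* suc j) ∎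
  where
  open ≡-Reasoning
  x = fromℕ j
  y = 1ℚ + x
  r = oddRecip j
  s = (- 1ℚ) ^ j
  f = fromℕ (j !)
  d = fromℕ (2 ℕ.* j)
  v = invFact (suc (suc (2 ℕ.* j)))

-1^n-involutive : ∀ n → (- 1ℚ) ^ n * (- 1ℚ) ^ n ≡ 1ℚ
-1^n-involutive zero    = refl
-1^n-involutive (suc n) = trans
  (solve 1 (λ s → con (- 1ℚ) :* s :* (con (- 1ℚ) :* s) := s :* s) refl ((- 1ℚ) ^ n))
  (-1^n-involutive n)

fromℕ-^8 : ∀ m → fromℕ (m ℕ.^ 8) ≡ fromℕ m ³ * fromℕ m ³ * fromℕ m ²
fromℕ-^8 m = trans (homo 8) (solve 1 (λ x → let o = con 1ℚ in
  x :* (x :* (x :* (x :* (x :* (x :* (x :* (x :* o)))))))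
  := x :* x :* x :* (x :* x :* x) :* (x :* x)) refl (fromℕ m))
  where
  homo : ∀ k → fromℕ (m ℕ.^ k) ≡ fromℕ m ^ k
  homo zero    = refl
  homo (suc k) = trans (fromℕ-* m (m ℕ.^ k)) (cong (fromℕ m *_) (homo k))

/-invFact : ∀ m j k →
  _/_ (ℤ.+ m) (j ! ℕ.* k !) {{j !* k !≢0}} ≡ fromℕ m * invFact j * invFact k
/-invFact m j k = begin
  q                              ≡⟨ solve 1 (λ q → q := q :* con 1ℚ :* con 1ℚ) refl q ⟩
  q * 1ℚ * 1ℚ                    ≡⟨ cong₂ (λ x y → q * x * y) (!-invFact j) (!-invFact k) ⟨
  q * (g * invFact j) * (h * invFact k)
    ≡⟨ solve 5 (λ q g h i l → q :* (g :* i) :* (h :* l) := q :* (g :* h) :* i :* l) refl q g h (invFact j) (invFact k) ⟩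
  q * (g * h) * invFact j * invFact k
    ≡⟨ cong (λ x → q * x * invFact j * invFact k) (fromℕ-* (j !) (k !)) ⟨
  q * fromℕ (j ! ℕ.* k !) * invFact j * invFact k
    ≡⟨ cong (λ x → x * invFact j * invFact k) (/-*-cancel m (j ! ℕ.* k !) {{j !* k !≢0}}) ⟩
  fromℕ m * invFact j * invFact k ∎
  where
  open ≡-Reasoning
  q = _/_ (ℤ.+ m) (j ! ℕ.* k !) {{j !* k !≢0}}
  g = fromℕ (j !)
  h = fromℕ (k !)

-- The sign from `p-triangular` cancels the sign of κⱼ. Of the eight factors j!, four come from κⱼ,
-- three from the cube in `pairing` and one from `falling j j`.
p-diagonal : ∀ j → p j j ≡
  _/_ (ℤ.+ ((j !) ℕ.^ 8)) ((2 ℕ.* j) ! ℕ.* (2 ℕ.* j ℕ.+ 1) !) {{(2 ℕ.* j) !* (2 ℕ.* j ℕ.+ 1) !≢0}}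
p-diagonal j = begin
  p j j
    ≡⟨ p-triangular {j} {j} ℕ.≤-refl ⟩
  s * (κ j * f ³ * falling j j * invFact (suc (j ℕ.+ j)))
    ≡⟨ cong₂ (λ k m → s * (k * m)) (cong₂ (λ k u → k * f ³ * u) (κ-closed j) (falling-diagonal j)) (cong invFact index) ⟩
  s * (s * (f ² * f ²) * i * f ³ * f * i′)
    ≡⟨ solve 4 (λ s f i i′ → s :* (s :* (f :* f :* (f :* f)) :* i :* (f :* f :* f) :* f :* i′)
         := s :* s :* ((f :* f :* f) :* (f :* f :* f) :* (f :* f) :* i :* i′)) refl s f i i′ ⟩
  s * s * (f ³ * f ³ * f ² * i * i′)
    ≡⟨ cong₂ (λ t g → t * (g * i * i′)) (-1^n-involutive j) (sym (fromℕ-^8 (j !))) ⟩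
  1ℚ * (fromℕ ((j !) ℕ.^ 8) * i * i′)
    ≡⟨ *-identityˡ _ ⟩
  fromℕ ((j !) ℕ.^ 8) * i * i′
    ≡⟨ /-invFact ((j !) ℕ.^ 8) (2 ℕ.* j) (2 ℕ.* j ℕ.+ 1) ⟨
  _ ∎
  where
  open ≡-Reasoning
  s = (- 1ℚ) ^ j
  f = fromℕ (j !)
  i = invFact (2 ℕ.* j)
  i′ = invFact (2 ℕ.* j ℕ.+ 1)
  index : suc (j ℕ.+ j) ≡ 2 ℕ.* j ℕ.+ 1
  index = trans (cong (λ m → suc (j ℕ.+ m)) (sym (ℕ.+-identityʳ j))) (ℕ.+-comm 1 (2 ℕ.* j))

open import Data.Integer.Base using (+_)

corollary5p4 : ∀ (n : ℕ) →
    H n (λ k → fromℕ (2 ℕ.* k ℕ.+ 1) * B (2 ℕ.* k) ½)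
      ≡ ∏[ℓ=1⋯ n ] (λ ℓ →
          _/_ (+ ((ℓ !) ℕ.^ 8)) ((2 ℕ.* ℓ) ! ℕ.* (2 ℕ.* ℓ ℕ.+ 1) !)
              {{(2 ℕ.* ℓ) !* (2 ℕ.* ℓ ℕ.+ 1) !≢0}})
corollary5p4 n = begin
  H n moments
    ≡⟨ hankel-det α β moments n p-orthogonal ⟩
  p 0 0 * product {n} (λ i → p (suc (toℕ i)) (suc (toℕ i)))
    -- The matrix has n + 1 diagonal entries; the one at index 0 equals 1, so the product starts at
    -- ℓ = 1.
    ≡⟨ cong₂ _*_ (p-diagonal 0) (sum-cong-≗ *-1-monoid {n} λ i → p-diagonal (suc (toℕ i))) ⟩
  1ℚ * product {n} _
    ≡⟨ *-identityˡ _ ⟩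
  product {n} _ ∎
  where open ≡-Reasoning
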